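{- Let $G=(V,E)$ be a finite graph that has a cycle double cover by triangles. Choose $A,B\subseteq E$ independently and uniformly at random, and let $\Gamma$ be the event that $A$ and $B$ are both eulerian and $A\cup B=E$. Then $$\mathrm{Bias}(|A|\equiv |B|+1\ (\mathrm{mod}\ 3)\mid\Gamma)=\mathrm{Bias}(|A|\equiv|B|+2\ (\mathrm{mod}\ 3)\mid\Gamma)$$ and $$\frac{\mathrm{Bias}(|A|\equiv |B|\ (\mathrm{mod}\ 3)\mid\Gamma)-\mathrm{Bias}(|A|\equiv |B|+1\ (\mathrm{mod}\ 3)\mid\Gamma)}{\mathrm{Bias}(|A|\equiv |B|\ (\mathrm{mod}\ 3))-\mathrm{Bias}(|A|\equiv|B|+1\ (\mathrm{mod}\ 3))}=\frac{2^{3|E|-2|V|}P(G;4)}{F(G;4)}.$$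
   Context: Graphs are finite; loops and parallel edges are permitted. A cycle double cover of $G$ by triangles is a family (repetitions allowed) of triangles (cycles of length 3) of $G$ such that each edge of $G$ belongs to exactly two members of the family. A subset $A\subseteq E$ is identified with the subgraph $(V,A)$ of $G$; it is called eulerian if all its vertex degrees are even. $P(G;q)$ is the number of proper vertex $q$-colourings of $G$; $F(G;q)$ is the number of nowhere-zero $\mathbb{Z}_q$-flows of $G$ (with respect to any fixed orientation); $F(G;4)$ is also the number of nowhere-zero $\mathbb{F}_4$-flows. For an event $\Sigma$, $\mathrm{Bias}(\Sigma)=\mathbb{P}(\Sigma)-\mathbb{P}(\overline{\Sigma})$ and $\mathrm{Bias}(\Sigma\mid\Gamma)=\mathbb{P}(\Sigma\mid\Gamma)-\mathbb{P}(\overline{\Sigma}\mid\Gamma)$, where $\overline{\Sigma}$ is the complement of $\Sigma$. -}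

module Defs where

import Algebra.Properties.CommutativeMonoid.Sum
open import Data.Bool.Base using (Bool; true; false; if_then_else_)
import Data.Bool.Properties as Bool
open import Data.Fin.Base using (Fin; toℕ)
open import Data.Fin.Properties using (_≟_; all?)
open import Data.Fin.Subset using (Subset; ∣_∣; _∪_; ⊤)
open import Data.Integer.Base as ℤ using (ℤ; +_; -[1+_])
open import Data.List.Base using (List; []; _∷_; length; filter; allFin; cartesianProduct; cartesianProductWith)
open import Data.List.Membership.Propositional using (_∈_)
open import Data.List.Membership.Propositional.Properties using (∈-cartesianProduct⁺; ∈-cartesianProductWith⁺; ∈-length)
open import Data.List.Relation.Unary.Any using (here)
open import Data.Nat.Base as ℕ using (ℕ; zero; suc; _+_; _*_; _^_; _%_)
open import Data.Nat.Divisibility using (_∣_; _∣?_)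
import Data.Nat.Properties as ℕ
open import Data.Product.Base using (_×_; _,_; proj₁; proj₂; Σ-syntax)
open import Data.Rational.Base as ℚ using (ℚ; NonZero; _/_; _÷_; _-_)
open import Data.Sum.Base using (_⊎_)
open import Data.Vec.Base using (Vec; []; _∷_; lookup)
open import Data.Vec.Properties using (≡-dec)
open import Level using (0ℓ)
open import Relation.Binary.PropositionalEquality using (_≡_; _≢_; refl)
open import Relation.Nullary.Decidable using (does; ¬?; _⊎-dec_; _×-dec_)
open import Relation.Unary using (Pred; Decidable)
open import Relation.Unary.Properties using (∁?; _∩?_)

open Algebra.Properties.CommutativeMonoid.Sum ℕ.+-0-commutativeMonoid public using (sum; sum-syntax)

infix 8 2^_

2^_ : ℤ → ℚ
2^ (+ n)    = + (2 ^ n) / 1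
2^ -[1+ n ] = (+ 1 / (2 ^ suc n)) {{ℕ.m^n≢0 2 (suc n)}}

fromℕ : ℕ → ℚ
fromℕ n = + n / 1

count : {A : Set} {P : Pred A 0ℓ} → Decidable P → List A → ℕ
count P? xs = length (filter P? xs)

-- Every vector with entries drawn from xs; each occurs exactly once
-- when xs has no repetitions.
allVecs : {A : Set} → List A → (n : ℕ) → List (Vec A n)
allVecs xs zero    = [] ∷ []
allVecs xs (suc n) = cartesianProductWith _∷_ xs (allVecs xs n)

-- Edges are labelled, so loops and parallel edges are allowed.  The order
-- (tail , head) of the two ends is only a reference orientation: flows use
-- it, every other notion below is symmetric in the ends.
record Graph : Set where
  field
    ∣V∣  : ℕ
    ∣E∣  : ℕ
    ends : Fin ∣E∣ → Fin ∣V∣ × Fin ∣V∣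

  tail head : Fin ∣E∣ → Fin ∣V∣
  tail e = proj₁ (ends e)
  head e = proj₂ (ends e)

  Joins : Fin ∣E∣ → Fin ∣V∣ → Fin ∣V∣ → Set
  Joins e u v = ends e ≡ (u , v) ⊎ ends e ≡ (v , u)

open Graph public

-- Distinctness of the vertices forces the three edges to be distinct
-- non-loops.  A cycle has several such presentations; since only families
-- of triangles covering each edge twice are considered, this is harmless.
record Triangle (G : Graph) : Set where
  field
    u v w    : Fin (∣V∣ G)
    u≢v      : u ≢ v
    v≢w      : v ≢ w
    w≢u      : w ≢ u
    a b c    : Fin (∣E∣ G)
    a-joins  : Joins G a u v
    b-joins  : Joins G b v w
    c-joins  : Joins G c w u

Uses : {G : Graph} → Fin (∣E∣ G) → Pred (Triangle G) 0ℓ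
Uses e T = e ≡ a ⊎ e ≡ b ⊎ e ≡ c
  where open Triangle T

uses? : {G : Graph} (e : Fin (∣E∣ G)) → Decidable (Uses {G} e)
uses? e T = (e ≟ a) ⊎-dec (e ≟ b) ⊎-dec (e ≟ c)
  where open Triangle T

TriangleDoubleCover : Graph → Set
TriangleDoubleCover G =
  Σ[ 𝒯 ∈ List (Triangle G) ] (∀ e → count (uses? {G} e) 𝒯 ≡ 2)

Proper : (G : Graph) (q : ℕ) → Pred (Vec (Fin q) (∣V∣ G)) 0ℓ
Proper G q κ = ∀ e → lookup κ (tail G e) ≢ lookup κ (head G e)

proper? : (G : Graph) (q : ℕ) → Decidable (Proper G q)
proper? G q κ = all? λ e → ¬? (lookup κ (tail G e) ≟ lookup κ (head G e))

P : Graph → ℕ → ℕ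
P G q = count (proper? G q) (allVecs (allFin q) (∣V∣ G))

-- ℤ_q is represented by residues in Fin q; sums are formed in ℕ and
-- compared modulo q.
module _ (G : Graph) (q : ℕ) where

  inflow outflow : Vec (Fin q) (∣E∣ G) → Fin (∣V∣ G) → ℕ
  inflow  φ x = ∑[ e < ∣E∣ G ] (if does (head G e ≟ x) then toℕ (lookup φ e) else 0)
  outflow φ x = ∑[ e < ∣E∣ G ] (if does (tail G e ≟ x) then toℕ (lookup φ e) else 0)

  NowhereZeroFlow : .{{ℕ.NonZero q}} → Pred (Vec (Fin q) (∣E∣ G)) 0ℓ
  NowhereZeroFlow φ = (∀ x → inflow φ x % q ≡ outflow φ x % q)
                    × (∀ e → toℕ (lookup φ e) ≢ 0)

  nowhereZeroFlow? : .{{_ : ℕ.NonZero q}} → Decidable NowhereZeroFlow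
  nowhereZeroFlow? φ = all? (λ x → inflow φ x % q ℕ.≟ outflow φ x % q)
                 ×-dec all? (λ e → ¬? (toℕ (lookup φ e) ℕ.≟ 0))

F : Graph → (q : ℕ) → .{{ℕ.NonZero q}} → ℕ
F G q = count (nowhereZeroFlow? G q) (allVecs (allFin q) (∣E∣ G))

-- A loop of A at x contributes 2.
degree : (G : Graph) → Subset (∣E∣ G) → Fin (∣V∣ G) → ℕ
degree G A x = ∑[ e < ∣E∣ G ] (if lookup A e then at (tail G e) + at (head G e) else 0)
  where
  at : Fin (∣V∣ G) → ℕ
  at y = if does (y ≟ x) then 1 else 0

Eulerian : (G : Graph) → Pred (Subset (∣E∣ G)) 0ℓ
Eulerian G A = ∀ x → 2 ∣ degree G A x

eulerian? : (G : Graph) → Decidable (Eulerian G)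
eulerian? G A = all? λ x → 2 ∣? degree G A x

-- Choosing A and B independently and uniformly amounts to choosing the
-- pair (A , B) uniformly.
Pair : ℕ → Set
Pair m = Subset m × Subset m

subsets : (m : ℕ) → List (Subset m)
subsets = allVecs (true ∷ false ∷ [])

pairs : (m : ℕ) → List (Pair m)
pairs m = cartesianProduct (subsets m) (subsets m)

pairs-nonZero : ∀ m → ℕ.NonZero (length (pairs m))
pairs-nonZero m = ℕ.>-nonZero (∈-length (∈-cartesianProduct⁺ (⊤∈subsets m) (⊤∈subsets m)))
  where
  ⊤∈subsets : ∀ k → ⊤ {k} ∈ subsets k
  ⊤∈subsets zero    = here refl
  ⊤∈subsets (suc k) = ∈-cartesianProductWith⁺ _∷_ {xs = true ∷ false ∷ []} (here refl) (⊤∈subsets k)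

module _ {m : ℕ} where

  ℙ : {S : Pred (Pair m) 0ℓ} → Decidable S → ℚ
  ℙ S? = (+ count S? (pairs m) / length (pairs m)) {{pairs-nonZero m}}

  Bias : {S : Pred (Pair m) 0ℓ} → Decidable S → ℚ
  Bias S? = ℙ S? - ℙ (∁? S?)

  ℙ[_∣_] : {S T : Pred (Pair m) 0ℓ} → Decidable S → (T? : Decidable T) →
           .{{NonZero (ℙ T?)}} → ℚ
  ℙ[ S? ∣ T? ] = ℙ (S? ∩? T?) ÷ ℙ T?

  Bias[_∣_] : {S T : Pred (Pair m) 0ℓ} → Decidable S → (T? : Decidable T) →
              .{{NonZero (ℙ T?)}} → ℚ
  Bias[ S? ∣ T? ] = ℙ[ S? ∣ T? ] - ℙ[ ∁? S? ∣ T? ]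

Γ : (G : Graph) → Pred (Pair (∣E∣ G)) 0ℓ
Γ G (A , B) = Eulerian G A × Eulerian G B × A ∪ B ≡ ⊤

Γ? : (G : Graph) → Decidable (Γ G)
Γ? G (A , B) = eulerian? G A ×-dec eulerian? G B ×-dec ≡-dec Bool._≟_ (A ∪ B) ⊤

-- |A| ≡ |B| + k (mod 3)
Shift : (G : Graph) → ℕ → Pred (Pair (∣E∣ G)) 0ℓ
Shift G k (A , B) = ∣ A ∣ % 3 ≡ (∣ B ∣ + k) % 3

shift? : (G : Graph) (k : ℕ) → Decidable (Shift G k)
shift? G k (A , B) = ∣ A ∣ % 3 ℕ.≟ (∣ B ∣ + k) % 3

{-# OPTIONS --safe #-}

-- A pair (A , B) in Γ is a nowhere-zero 𝔽₄-flow φ, and ω^(|A| - |B|) is the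
-- product over the edges of χ(φ e) for a cubic character χ of 𝔽₄ˣ.  Poisson
-- summation turns Σ_Γ ω^(|A| - |B|) into 4^(-|V|) times a sum over the
-- 𝔽₄-labellings κ of the vertices of the products of the Gauss sums
-- χ̂(δκ(e)).  Since χ̂(0) = 0 and χ̂(y) = 2 χ̄(y) otherwise, only proper
-- colourings contribute, each 2^|E| times a product of cube roots of unity.  The
-- three values of δκ on a triangle are the three elements of 𝔽₄ˣ, so the cube
-- roots multiply to 1 on it; by the double cover the square of the
-- product over all edges is 1, hence so is the product.  Thus the sum is
-- 2^|E| 4^(-|V|) P(G;4), while the sum over all pairs is (1 + ω + ω² + 1)^|E| = 1.
--
-- That |Γ| = F(G;4) is also Poisson summation: for ℤ₄- and for 𝔽₄-flows the
-- dual sum weighs an edge by 3 or -1 as its ends have equal labels or not.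
-- Γ is inhabited because a flow that vanishes nowhere on the first triangles
-- can be shifted along the next one by a value avoiding its three edge values.
module Submission where

open import Defs hiding (sum; sum-syntax)
import Algebra.Properties.CommutativeMonoid.Sum
import Algebra.Properties.CommutativeSemiring.Exp
import Algebra.Properties.Monoid.Mult
import Algebra.Properties.Semiring.Sum
open import Algebra.Bundles using (CommutativeMonoid; CommutativeSemiring)
open import Algebra.Structures.Biased using (isCommutativeSemiringˡ)
open import Data.Bool.Base using (Bool; true; false; if_then_else_; not; _∧_; _∨_; _xor_)
import Data.Bool.Properties as Bool
open import Data.Fin.Base using (Fin; zero; suc; toℕ; fromℕ<)
open import Data.Fin.Properties using (_≟_; all?; ¬∀⟶∃¬; suc-injective; toℕ-fromℕ<)
open import Data.Fin.Subset using (Subset; ∣_∣; _∪_; ⊤; ⊥)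
open import Data.Integer.Base as ℤ using (ℤ; +_; 0ℤ; 1ℤ; -1ℤ)
import Data.Integer.Properties as ℤ
import Data.Integer.Tactic.RingSolver as ℤ-Solver
open import Data.List.Base
  using (List; []; _∷_; _++_; map; length; filter; allFin; cartesianProduct; cartesianProductWith)
open import Data.List.Membership.Propositional using (_∈_)
open import Data.List.Membership.Propositional.Properties
  using (∈-cartesianProduct⁺; ∈-cartesianProductWith⁺; ∈-filter⁺; ∈-length)
open import Data.List.Properties using (filter-reject; length-++; length-map)
open import Data.List.Relation.Unary.Any using (here; there)
open import Data.Nat.Base as ℕ using (ℕ; zero; suc)
open import Data.Nat.DivMod using (m≡m%n+[m/n]*n; m%n<n; %-distribˡ-+)
open import Data.Nat.Divisibility using (_∣_; _∣?_; divides; m∣m*n; ∣m∣n⇒∣m+n; ∣m+n∣m⇒∣n)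
import Data.Nat.Properties as ℕ
import Data.Nat.Tactic.RingSolver as ℕ-Solver
open import Data.Product.Base using (_×_; _,_; proj₁; proj₂; Σ-syntax)
import Data.Product.Properties as Product
open import Data.Sum.Base using (inj₁; inj₂)
open import Data.Vec.Base as Vec using (Vec; []; _∷_; lookup; tabulate)
open import Data.Vec.Properties
  using (lookup-map; lookup-replicate; lookup-zipWith; lookup∘tabulate; ≡-dec)
open import Data.Vec.Relation.Binary.Pointwise.Extensional using (ext; Pointwise-≡⇒≡)
open import Function.Base using (_∘_)
open import Level using (0ℓ)
open import Relation.Binary.PropositionalEquality as ≡ using (_≡_; _≢_; cong; cong₂)
open import Relation.Nullary using (Dec; yes; no; does; contradiction; ¬_; ¬?)
open import Relation.Nullary.Decidable using (_×-dec_; _→-dec_; from-yes)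
open import Relation.Unary using (Pred; Decidable)
open import Relation.Unary.Properties using (∁?; _∩?_)

module ℕ∑ = Algebra.Properties.Semiring.Sum ℕ.+-*-semiring

-- Counting, and sums over the edges of triangles.

module _ {A : Set} {P Q : Pred A 0ℓ} (P? : Decidable P) (Q? : Decidable Q) where

  count-∩ : ∀ xs → count (P? ∩? Q?) xs ≡ count P? (filter Q? xs)
  count-∩ []       = ≡.refl
  count-∩ (x ∷ xs) with does (Q? x)
  ... | false with does (P? x)
  ...   | true  = count-∩ xs
  ...   | false = count-∩ xs
  count-∩ (x ∷ xs) | true with does (P? x)
  ...   | true  = cong suc (count-∩ xs)
  ...   | false = count-∩ xs

count-∁ : {A : Set} {P : Pred A 0ℓ} (P? : Decidable P) (xs : List A) →
          count P? xs ℕ.+ count (∁? P?) xs ≡ length xs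
count-∁ P? []       = ≡.refl
count-∁ P? (x ∷ xs) with does (P? x)
... | true  = cong suc (count-∁ P? xs)
... | false = ≡.trans (ℕ.+-suc _ _) (cong suc (count-∁ P? xs))

module FinSum {ℓ₁ ℓ₂} (M : CommutativeMonoid ℓ₁ ℓ₂) where
  open CommutativeMonoid M
  open Algebra.Properties.CommutativeMonoid.Sum M public
  open Algebra.Properties.Monoid.Mult monoid using () renaming (_×_ to _⋆_)
  open import Relation.Binary.Reasoning.Setoid setoid

  sum-zero : ∀ {n} (f : Fin n → Carrier) → (∀ i → f i ≈ ε) → sum f ≈ ε
  sum-zero {n} f f≈0 = trans (sum-cong-≋ f≈0) (sum-replicate-zero n)

  sum-only : ∀ {n} (i : Fin n) (f : Fin n → Carrier) →
             (∀ j → j ≢ i → f j ≈ ε) → sum f ≈ f i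
  sum-only zero    f f≈0 =
    trans (∙-congˡ (sum-zero (f ∘ suc) (λ j → f≈0 (suc j) λ ()))) (identityʳ _)
  sum-only (suc i) f f≈0 =
    trans (∙-cong (f≈0 zero λ ()) (sum-only i (f ∘ suc) λ j j≢i → f≈0 (suc j) (j≢i ∘ suc-injective)))
          (identityˡ _)

  sum-≟ˡ : ∀ {n} (i : Fin n) (f : Fin n → Carrier) →
           ∑[ j < n ] (if does (i ≟ j) then f j else ε) ≈ f i
  sum-≟ˡ i f = trans (sum-only i _ off) on
    where
    off : ∀ j → j ≢ i → (if does (i ≟ j) then f j else ε) ≈ ε
    off j j≢i with i ≟ j
    ... | yes i≡j = contradiction (≡.sym i≡j) j≢i
    ... | no  _   = refl
    on : (if does (i ≟ i) then f i else ε) ≈ f i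
    on with i ≟ i
    ... | yes _   = refl
    ... | no  i≢i = contradiction ≡.refl i≢i

  sum-≟ʳ : ∀ {n} (i : Fin n) (f : Fin n → Carrier) →
           ∑[ j < n ] (if does (j ≟ i) then f j else ε) ≈ f i
  sum-≟ʳ i f = trans (sum-only i _ off) on
    where
    off : ∀ j → j ≢ i → (if does (j ≟ i) then f j else ε) ≈ ε
    off j j≢i with j ≟ i
    ... | yes j≡i = contradiction j≡i j≢i
    ... | no  _   = refl
    on : (if does (i ≟ i) then f i else ε) ≈ f i
    on with i ≟ i
    ... | yes _   = refl
    ... | no  i≢i = contradiction ≡.refl i≢i

  module _ (G : Graph) where

    open Triangle

    -- The three edges are distinct, so the indicator of using one of them splits into three
    -- one-edge indicators. The monoid is left open: it is multiplicative for the colours and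
    -- additive for the degrees.
    sum-triangle : (T : Triangle G) (f : Fin (∣E∣ G) → Carrier) →
      ∑[ e < ∣E∣ G ] (if does (uses? {G} e T) then f e else ε) ≈ f (a T) ∙ (f (b T) ∙ f (c T))
    sum-triangle T f = begin
      sum (λ e → if does (uses? {G} e T) then f e else ε)  ≈⟨ sum-cong-≋ split ⟩
      sum (λ e → at (a T) e ∙ (at (b T) e ∙ at (c T) e))     ≈⟨ ∑-distrib-+ (at (a T)) _ ⟩
      sum (at (a T)) ∙ sum (λ e → at (b T) e ∙ at (c T) e)   ≈⟨ ∙-congˡ (∑-distrib-+ (at (b T)) (at (c T))) ⟩
      sum (at (a T)) ∙ (sum (at (b T)) ∙ sum (at (c T)))
        ≈⟨ ∙-cong (sum-≟ʳ (a T) f) (∙-cong (sum-≟ʳ (b T) f) (sum-≟ʳ (c T) f)) ⟩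
      f (a T) ∙ (f (b T) ∙ f (c T))                        ∎
      where
      at : Fin (∣E∣ G) → Fin (∣E∣ G) → Carrier
      at i e = if does (e ≟ i) then f e else ε

      -- Otherwise two of the three vertices would coincide, whichever way the edge is oriented.
      -- Rotating the vertices cyclically covers the three possible coincidences of edges in
      -- `split`.
      distinct : ∀ {e x y z} → x ≢ y → y ≢ z → z ≢ x → Joins G e x y → ¬ Joins G e y z
      distinct x≢y y≢z z≢x (inj₁ p) (inj₁ q) = x≢y (cong proj₁ (≡.trans (≡.sym p) q))
      distinct x≢y y≢z z≢x (inj₁ p) (inj₂ q) = z≢x (cong proj₁ (≡.trans (≡.sym q) p))
      distinct x≢y y≢z z≢x (inj₂ p) (inj₁ q) = z≢x (cong proj₂ (≡.trans (≡.sym q) p))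
      distinct x≢y y≢z z≢x (inj₂ p) (inj₂ q) = y≢z (cong proj₁ (≡.trans (≡.sym p) q))

      split : ∀ e → (if does (uses? {G} e T) then f e else ε) ≈ at (a T) e ∙ (at (b T) e ∙ at (c T) e)
      split e with e ≟ a T | e ≟ b T | e ≟ c T
      ... | yes ≡.refl | yes e≡b | _ = contradiction
        (≡.subst (λ e → Joins G e _ _) (≡.sym e≡b) (b-joins T)) (distinct (u≢v T) (v≢w T) (w≢u T) (a-joins T))
      ... | yes ≡.refl | no _ | yes e≡c = contradiction
        (a-joins T) (distinct (w≢u T) (u≢v T) (v≢w T) (≡.subst (λ e → Joins G e _ _) (≡.sym e≡c) (c-joins T)))
      ... | yes _ | no _ | no _ = sym (trans (∙-congˡ (identityˡ _)) (identityʳ _))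
      ... | no _ | yes ≡.refl | yes e≡c = contradiction
        (≡.subst (λ e → Joins G e _ _) (≡.sym e≡c) (c-joins T)) (distinct (v≢w T) (w≢u T) (u≢v T) (b-joins T))
      ... | no _ | yes _ | no _ = sym (trans (identityˡ _) (identityʳ _))
      ... | no _ | no _ | yes _ = sym (trans (identityˡ _) (identityˡ _))
      ... | no _ | no _ | no _ = sym (trans (identityˡ _) (identityˡ _))

    -- Double counting: the multiplicity of `f e` is the number of triangles through `e`, so
    -- regrouping by triangles leaves only trivial contributions.
    sum-cover : (𝒯 : List (Triangle G)) (f : Fin (∣E∣ G) → Carrier) →
      (∀ (T : Triangle G) → f (a T) ∙ (f (b T) ∙ f (c T)) ≈ ε) →
      ∑[ e < ∣E∣ G ] (count (uses? {G} e) 𝒯 ⋆ f e) ≈ ε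
    sum-cover []      f _  = sum-zero {∣E∣ G} _ λ _ → refl
    sum-cover (T ∷ 𝒯) f f≈ = begin
      sum (λ e → count (uses? {G} e) (T ∷ 𝒯) ⋆ f e)  ≈⟨ sum-cong-≋ split ⟩
      sum (λ e → (if does (uses? {G} e T) then f e else ε) ∙ (count (uses? {G} e) 𝒯 ⋆ f e))
        ≈⟨ ∑-distrib-+ {∣E∣ G} _ _ ⟩
      sum (λ e → if does (uses? {G} e T) then f e else ε) ∙ sum (λ e → count (uses? {G} e) 𝒯 ⋆ f e)
        ≈⟨ ∙-cong (trans (sum-triangle T f) (f≈ T)) (sum-cover 𝒯 f f≈) ⟩
      ε ∙ ε                                       ≈⟨ identityˡ ε ⟩
      ε                                           ∎
      where
      split : ∀ e → count (uses? {G} e) (T ∷ 𝒯) ⋆ f e ≈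
                    (if does (uses? {G} e T) then f e else ε) ∙ (count (uses? {G} e) 𝒯 ⋆ f e)
      split e with does (uses? {G} e T)
      ... | true  = refl
      ... | false = sym (identityˡ _)

-- Poisson summation on graphs

module ListSum {c ℓ} (R : CommutativeSemiring c ℓ) where
  open CommutativeSemiring R hiding (zero) renaming (Carrier to C)
  open Algebra.Properties.CommutativeSemiring.Exp R using (_^_; ^-homo-*)
  open Algebra.Properties.Monoid.Mult +-monoid using () renaming (_×_ to _⋆_)
  open import Relation.Binary.Reasoning.Setoid setoid
  open import Algebra.Properties.CommutativeSemigroup +-commutativeSemigroup using (interchange)

  module ∏ = FinSum *-commutativeMonoid

  ∏ : ∀ {n} → (Fin n → C) → C
  ∏ = ∏.sum

  ∑ : {A : Set} → List A → (A → C) → C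
  ∑ []       f = 0#
  ∑ (x ∷ xs) f = f x + ∑ xs f

  [_] : {P : Set} → Dec P → C
  [ d ] = if does d then 1# else 0#

  ∏-cong : ∀ {n} {f g : Fin n → C} → (∀ i → f i ≈ g i) → ∏ f ≈ ∏ g
  ∏-cong = ∏.sum-cong-≋

  module _ {A : Set} where

    ∑-cong : (xs : List A) {f g : A → C} → (∀ x → f x ≈ g x) → ∑ xs f ≈ ∑ xs g
    ∑-cong []       _   = refl
    ∑-cong (x ∷ xs) f≈g = +-cong (f≈g x) (∑-cong xs f≈g)

    ∑-zero : (xs : List A) → ∑ xs (λ _ → 0#) ≈ 0#
    ∑-zero []       = refl
    ∑-zero (x ∷ xs) = trans (+-identityˡ _) (∑-zero xs)

    ∑-+ : (xs : List A) (f g : A → C) → ∑ xs (λ x → f x + g x) ≈ ∑ xs f + ∑ xs g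
    ∑-+ []       f g = sym (+-identityˡ 0#)
    ∑-+ (x ∷ xs) f g = trans (+-congˡ (∑-+ xs f g)) (interchange _ _ _ _)

    ∑-distribˡ : ∀ y (xs : List A) (f : A → C) → y * ∑ xs f ≈ ∑ xs (λ x → y * f x)
    ∑-distribˡ y []       f = zeroʳ y
    ∑-distribˡ y (x ∷ xs) f = trans (distribˡ _ _ _) (+-congˡ (∑-distribˡ y xs f))

    ∑-distribʳ : ∀ y (xs : List A) (f : A → C) → ∑ xs f * y ≈ ∑ xs (λ x → f x * y)
    ∑-distribʳ y xs f = begin
      ∑ xs f * y            ≈⟨ *-comm _ y ⟩
      y * ∑ xs f            ≈⟨ ∑-distribˡ y xs f ⟩
      ∑ xs (λ x → y * f x)  ≈⟨ ∑-cong xs (λ x → *-comm y (f x)) ⟩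
      ∑ xs (λ x → f x * y)  ∎

    ∑-++ : (xs ys : List A) (f : A → C) → ∑ (xs ++ ys) f ≈ ∑ xs f + ∑ ys f
    ∑-++ []       ys f = sym (+-identityˡ _)
    ∑-++ (x ∷ xs) ys f = trans (+-congˡ (∑-++ xs ys f)) (sym (+-assoc _ _ _))

    count-∑ : {P : Pred A 0ℓ} (P? : Decidable P) (xs : List A) →
              count P? xs ⋆ 1# ≈ ∑ xs (λ x → [ P? x ])
    count-∑ P? []       = refl
    count-∑ P? (x ∷ xs) with does (P? x)
    ... | true  = +-congˡ (count-∑ P? xs)
    ... | false = trans (count-∑ P? xs) (sym (+-identityˡ _))

    ∑-filter : {P : Pred A 0ℓ} (P? : Decidable P) (xs : List A) (f : A → C) →
               ∑ (filter P? xs) f ≈ ∑ xs (λ x → [ P? x ] * f x)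
    ∑-filter P? []       f = refl
    ∑-filter P? (x ∷ xs) f with does (P? x)
    ... | true  = +-cong (sym (*-identityˡ _)) (∑-filter P? xs f)
    ... | false = trans (∑-filter P? xs f) (sym (trans (+-congʳ (zeroˡ _)) (+-identityˡ _)))

  ∑-map : {A B : Set} (g : A → B) (xs : List A) (f : B → C) → ∑ (map g xs) f ≈ ∑ xs (f ∘ g)
  ∑-map g []       f = refl
  ∑-map g (x ∷ xs) f = +-congˡ (∑-map g xs f)

  module _ {A B : Set} where

    ∑-comm : (xs : List A) (ys : List B) (f : A → B → C) →
             ∑ xs (λ x → ∑ ys (f x)) ≈ ∑ ys (λ y → ∑ xs (λ x → f x y))
    ∑-comm []       ys f = sym (∑-zero ys)
    ∑-comm (x ∷ xs) ys f = trans (+-congˡ (∑-comm xs ys f)) (sym (∑-+ ys _ _))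

    ∑-cartesian : {D : Set} (g : A → B → D) (xs : List A) (ys : List B) (f : D → C) →
      ∑ (cartesianProductWith g xs ys) f ≈ ∑ xs (λ x → ∑ ys (λ y → f (g x y)))
    ∑-cartesian g []       ys f = refl
    ∑-cartesian g (x ∷ xs) ys f =
      trans (∑-++ (map (g x) ys) _ f) (+-cong (∑-map (g x) ys f) (∑-cartesian g xs ys f))

  -- Expansion of a product of sums: choosing one summand from each factor amounts to choosing a
  -- vector.
  ∏-∑ : {A : Set} (xs : List A) (n : ℕ) (f : Fin n → A → C) →
        ∏ (λ i → ∑ xs (f i)) ≈ ∑ (allVecs xs n) (λ φ → ∏ (λ i → f i (lookup φ i)))
  ∏-∑ xs zero  f = sym (+-identityʳ 1#)
  ∏-∑ xs (suc n) f = begin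
    ∑ xs (f zero) * ∏ (λ i → ∑ xs (f (suc i)))
      ≈⟨ *-congˡ (∏-∑ xs n (f ∘ suc)) ⟩
    ∑ xs (f zero) * ∑ (allVecs xs n) (λ φ → ∏ (λ i → f (suc i) (lookup φ i)))
      ≈⟨ ∑-distribʳ _ xs _ ⟩
    ∑ xs (λ x → f zero x * ∑ (allVecs xs n) (λ φ → ∏ (λ i → f (suc i) (lookup φ i))))
      ≈⟨ ∑-cong xs (λ x → ∑-distribˡ _ (allVecs xs n) _) ⟩
    ∑ xs (λ x → ∑ (allVecs xs n) (λ φ → f zero x * ∏ (λ i → f (suc i) (lookup φ i))))
      ≈⟨ ∑-cartesian _∷_ xs (allVecs xs n) _ ⟨
    ∑ (allVecs xs (suc n)) (λ φ → ∏ (λ i → f i (lookup φ i)))  ∎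

  -- Passes between one labelling of the edges by bit pairs, which can be treated edge by edge, and
  -- the pair of subsets formed by its coordinates.
  ∑-unzip : {A B : Set} (xs : List A) (ys : List B) (n : ℕ) (f : Vec A n → Vec B n → C) →
    ∑ (allVecs (cartesianProduct xs ys) n) (λ φ → f (Vec.map proj₁ φ) (Vec.map proj₂ φ)) ≈
    ∑ (allVecs xs n) (λ α → ∑ (allVecs ys n) (f α))
  ∑-unzip xs ys zero    f = +-congʳ (sym (+-identityʳ _))
  ∑-unzip xs ys (suc n) f = begin
    ∑ (allVecs (cartesianProduct xs ys) (suc n)) (λ φ → f (Vec.map proj₁ φ) (Vec.map proj₂ φ))
      ≈⟨ ∑-cartesian _∷_ (cartesianProduct xs ys) (allVecs (cartesianProduct xs ys) n) _ ⟩
    ∑ (cartesianProduct xs ys) (λ z → ∑ (allVecs (cartesianProduct xs ys) n)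
       (λ φ → f (proj₁ z ∷ Vec.map proj₁ φ) (proj₂ z ∷ Vec.map proj₂ φ)))
      ≈⟨ ∑-cong (cartesianProduct xs ys) (λ z → ∑-unzip xs ys n (λ α β → f (proj₁ z ∷ α) (proj₂ z ∷ β))) ⟩
    ∑ (cartesianProduct xs ys) (λ z → ∑ (allVecs xs n) (λ α → ∑ (allVecs ys n) (λ β → f (proj₁ z ∷ α) (proj₂ z ∷ β))))
      ≈⟨ ∑-cartesian _,_ xs ys _ ⟩
    ∑ xs (λ x → ∑ ys (λ y → ∑ (allVecs xs n) (λ α → ∑ (allVecs ys n) (λ β → f (x ∷ α) (y ∷ β)))))
      ≈⟨ ∑-cong xs (λ x → ∑-comm ys (allVecs xs n) _) ⟩
    ∑ xs (λ x → ∑ (allVecs xs n) (λ α → ∑ ys (λ y → ∑ (allVecs ys n) (λ β → f (x ∷ α) (y ∷ β)))))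
      ≈⟨ ∑-cong xs (λ x → ∑-cong (allVecs xs n) (λ α → ∑-cartesian _∷_ ys (allVecs ys n) _)) ⟨
    ∑ xs (λ x → ∑ (allVecs xs n) (λ α → ∑ (allVecs ys (suc n)) (f (x ∷ α))))
      ≈⟨ ∑-cartesian _∷_ xs (allVecs xs n) _ ⟨
    ∑ (allVecs xs (suc n)) (λ α → ∑ (allVecs ys (suc n)) (f α))  ∎

  [×] : {P Q : Set} (p : Dec P) (q : Dec Q) → [ p ×-dec q ] ≈ [ p ] * [ q ]
  [×] p q with does p
  ... | true  = sym (*-identityˡ _)
  ... | false = sym (zeroˡ _)

  ∏-zero : ∀ {n} (f : Fin n → C) i → f i ≈ 0# → ∏ f ≈ 0#
  ∏-zero f zero    fi≈0 = trans (*-congʳ fi≈0) (zeroˡ _)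
  ∏-zero f (suc i) fi≈0 = trans (*-congˡ (∏-zero (f ∘ suc) i fi≈0)) (zeroʳ _)

  -- `P` need only be equivalent to the universal statement, so that the decision of `A ∪ B ≡ ⊤`,
  -- which is not an `all?`, is covered too.
  [∀] : ∀ {n} {P : Set} {Q : Fin n → Set} (p : Dec P) (q : ∀ i → Dec (Q i)) →
        (P → ∀ i → Q i) → ((∀ i → Q i) → P) → [ p ] ≈ ∏ (λ i → [ q i ])
  [∀] (yes p) q to from = sym (∏.sum-zero _ one)
    where
    one : ∀ i → [ q i ] ≈ 1#
    one i with q i
    ... | yes _  = refl
    ... | no ¬q  = contradiction (to p i) ¬q
  [∀] {Q = Q} (no ¬p) q to from with ¬∀⟶∃¬ _ Q q (¬p ∘ from)
  ... | i , ¬qi = sym (∏-zero _ i zro)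
    where
    zro : [ q i ] ≈ 0#
    zro with q i
    ... | yes qi = contradiction qi ¬qi
    ... | no _   = refl

  ∏-const : ∀ n x → ∏ {n} (λ _ → x) ≈ x ^ n
  ∏-const n x = ∏.sum-replicate n

  ^-sum : ∀ ζ n (f : Fin n → ℕ) → ∏ (λ i → ζ ^ f i) ≈ ζ ^ ℕ∑.sum f
  ^-sum ζ zero    f = refl
  ^-sum ζ (suc n) f = trans (*-congˡ (^-sum ζ n (f ∘ suc))) (sym (^-homo-* ζ (f zero) _))

  -- ζ ^ η x y and ζ ^ τ x y are the values at y of the character x and of its
  -- conjugate, so that ζ ^ exponent φ v x is the character x evaluated at the
  -- net flow of φ into v.
  module _ (G : Graph) (ζ : C) {X Y : Set} (η τ : X → Y → ℕ) where

    exponent : Vec Y (∣E∣ G) → Fin (∣V∣ G) → X → ℕ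
    exponent φ v x = ℕ∑.sum λ e →
      (if does (head G e ≟ v) then η x (lookup φ e) else 0) ℕ.+
      (if does (tail G e ≟ v) then τ x (lookup φ e) else 0)

    private
      -- Double counting of incidences: an edge contributes once at its head and once at its tail.
      sum-exponent : ∀ φ (κ : Vec X (∣V∣ G)) → ℕ∑.sum (λ v → exponent φ v (lookup κ v)) ≡
        ℕ∑.sum (λ e → η (lookup κ (head G e)) (lookup φ e) ℕ.+ τ (lookup κ (tail G e)) (lookup φ e))
      sum-exponent φ κ = ≡.trans (ℕ∑.∑-comm {∣V∣ G} {∣E∣ G} _) (ℕ∑.sum-cong-≗ {∣E∣ G} λ e →
        ≡.trans (ℕ∑.∑-distrib-+ {∣V∣ G} _ _) (cong₂ ℕ._+_
          (FinSum.sum-≟ˡ ℕ.+-0-commutativeMonoid (head G e) (λ v → η (lookup κ v) (lookup φ e)))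
          (FinSum.sum-≟ˡ ℕ.+-0-commutativeMonoid (tail G e) (λ v → τ (lookup κ v) (lookup φ e)))))

    -- The product over vertices is expanded into a sum over labellings κ and the two sums are
    -- exchanged. Regrouping the exponents by edges then lets the sum over φ factor over the edges.
    -- Orthogonality of characters enters only in `poisson-flows`.
    poisson : (xs : List X) (ys : List Y) (w : Y → C) →
      ∑ (allVecs ys (∣E∣ G)) (λ φ → ∏ (λ e → w (lookup φ e)) * ∏ (λ v → ∑ xs (λ x → ζ ^ exponent φ v x))) ≈
      ∑ (allVecs xs (∣V∣ G)) (λ κ → ∏ (λ e → ∑ ys (λ y →
        w y * ζ ^ (η (lookup κ (head G e)) y ℕ.+ τ (lookup κ (tail G e)) y))))
    poisson xs ys w = begin
      ∑ Φ (λ φ → W φ * ∏ (λ v → ∑ xs (λ x → ζ ^ exponent φ v x)))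
        ≈⟨ ∑-cong Φ (λ φ → *-congˡ (∏-∑ xs (∣V∣ G) _)) ⟩
      ∑ Φ (λ φ → W φ * ∑ K (λ κ → ∏ (λ v → ζ ^ exponent φ v (lookup κ v))))
        ≈⟨ ∑-cong Φ (λ φ → ∑-distribˡ _ K _) ⟩
      ∑ Φ (λ φ → ∑ K (λ κ → W φ * ∏ (λ v → ζ ^ exponent φ v (lookup κ v))))
        ≈⟨ ∑-comm Φ K _ ⟩
      ∑ K (λ κ → ∑ Φ (λ φ → W φ * ∏ (λ v → ζ ^ exponent φ v (lookup κ v))))
        ≈⟨ ∑-cong K (λ κ → ∑-cong Φ (λ φ → step φ κ)) ⟩
      ∑ K (λ κ → ∑ Φ (λ φ → ∏ (λ e → w (lookup φ e) * ζ ^ μ κ e (lookup φ e))))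
        ≈⟨ ∑-cong K (λ κ → ∏-∑ ys (∣E∣ G) _) ⟨
      ∑ K (λ κ → ∏ (λ e → ∑ ys (λ y → w y * ζ ^ μ κ e y)))  ∎
      where
      Φ = allVecs ys (∣E∣ G)
      K = allVecs xs (∣V∣ G)
      W = λ φ → ∏ (λ e → w (lookup φ e))
      μ = λ κ e y → η (lookup κ (head G e)) y ℕ.+ τ (lookup κ (tail G e)) y
      step : ∀ φ κ → W φ * ∏ (λ v → ζ ^ exponent φ v (lookup κ v)) ≈
                     ∏ (λ e → w (lookup φ e) * ζ ^ μ κ e (lookup φ e))
      step φ κ = begin
        W φ * ∏ (λ v → ζ ^ exponent φ v (lookup κ v))         ≈⟨ *-congˡ (^-sum ζ (∣V∣ G) _) ⟩
        W φ * ζ ^ ℕ∑.sum (λ v → exponent φ v (lookup κ v))    ≡⟨ cong (λ k → W φ * ζ ^ k) (sum-exponent φ κ) ⟩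
        W φ * ζ ^ ℕ∑.sum (λ e → μ κ e (lookup φ e))            ≈⟨ *-congˡ (^-sum ζ (∣E∣ G) _) ⟨
        W φ * ∏ (λ e → ζ ^ μ κ e (lookup φ e))                 ≈⟨ ∏.∑-distrib-+ {∣E∣ G} (λ e → w (lookup φ e)) _ ⟨
        ∏ (λ e → w (lookup φ e) * ζ ^ μ κ e (lookup φ e))      ∎

-- ℤ[θ] with θ² = s θ + t; the pair (a , b) stands for a + b θ.
module Quadratic (s t : ℤ) where

  open import Data.Integer.Base using (_+_; _*_)

  _⊕_ _⊗_ : ℤ × ℤ → ℤ × ℤ → ℤ × ℤ
  (a , b) ⊕ (c , d) = a + c , b + d
  (a , b) ⊗ (c , d) = a * c + t * (b * d) , (a * d + b * c) + s * (b * d)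

  commutativeSemiring : CommutativeSemiring 0ℓ 0ℓ
  commutativeSemiring = record
    { Carrier = ℤ × ℤ ; _≈_ = _≡_ ; _+_ = _⊕_ ; _*_ = _⊗_ ; 0# = 0ℤ , 0ℤ ; 1# = 1ℤ , 0ℤ
    ; isCommutativeSemiring = isCommutativeSemiringˡ record
      { +-isCommutativeMonoid = record
        { isMonoid = record
          { isSemigroup = record
            { isMagma = record { isEquivalence = ≡.isEquivalence ; ∙-cong = cong₂ _⊕_ }
            ; assoc = λ (a , b) (c , d) (e , f) → cong₂ _,_ (ℤ.+-assoc a c e) (ℤ.+-assoc b d f) }
          ; identity = (λ (a , b) → cong₂ _,_ (ℤ.+-identityˡ a) (ℤ.+-identityˡ b))
                     , (λ (a , b) → cong₂ _,_ (ℤ.+-identityʳ a) (ℤ.+-identityʳ b)) }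
        ; comm = λ (a , b) (c , d) → cong₂ _,_ (ℤ.+-comm a c) (ℤ.+-comm b d) }
      ; *-isCommutativeMonoid = record
        { isMonoid = record
          { isSemigroup = record
            { isMagma = record { isEquivalence = ≡.isEquivalence ; ∙-cong = cong₂ _⊗_ }
            ; assoc = λ (a , b) (c , d) (e , f) → cong₂ _,_ (assoc₁ s t a b c d e f) (assoc₂ s t a b c d e f) }
          ; identity = (λ (a , b) → cong₂ _,_ (one₁ t a b) (one₂ s a b))
                     , (λ (a , b) → cong₂ _,_ (one₃ t a b) (one₄ s a b)) }
        ; comm = λ (a , b) (c , d) → cong₂ _,_ (comm₁ t a b c d) (comm₂ s a b c d) }
      ; distribʳ = λ (a , b) (c , d) (e , f) → cong₂ _,_ (dist₁ t a b c d e f) (dist₂ s a b c d e f)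
      ; zeroˡ = λ (a , b) → cong₂ _,_ (zero₁ t a b) (zero₂ s a b)
      }
    }
    where
    assoc₁ : ∀ s t a b c d e f →
      (a * c + t * (b * d)) * e + t * (((a * d + b * c) + s * (b * d)) * f) ≡
      a * (c * e + t * (d * f)) + t * (b * ((c * f + d * e) + s * (d * f)))
    assoc₁ = ℤ-Solver.solve-∀
    assoc₂ : ∀ s t a b c d e f →
      ((a * c + t * (b * d)) * f + ((a * d + b * c) + s * (b * d)) * e) + s * (((a * d + b * c) + s * (b * d)) * f) ≡
      (a * ((c * f + d * e) + s * (d * f)) + b * (c * e + t * (d * f))) + s * (b * ((c * f + d * e) + s * (d * f)))
    assoc₂ = ℤ-Solver.solve-∀
    one₁ : ∀ t a b → 1ℤ * a + t * (0ℤ * b) ≡ a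
    one₁ = ℤ-Solver.solve-∀
    one₂ : ∀ s a b → (1ℤ * b + 0ℤ * a) + s * (0ℤ * b) ≡ b
    one₂ = ℤ-Solver.solve-∀
    one₃ : ∀ t a b → a * 1ℤ + t * (b * 0ℤ) ≡ a
    one₃ = ℤ-Solver.solve-∀
    one₄ : ∀ s a b → (a * 0ℤ + b * 1ℤ) + s * (b * 0ℤ) ≡ b
    one₄ = ℤ-Solver.solve-∀
    comm₁ : ∀ t a b c d → a * c + t * (b * d) ≡ c * a + t * (d * b)
    comm₁ = ℤ-Solver.solve-∀
    comm₂ : ∀ s a b c d → (a * d + b * c) + s * (b * d) ≡ (c * b + d * a) + s * (d * b)
    comm₂ = ℤ-Solver.solve-∀
    dist₁ : ∀ t a b c d e f → (c + e) * a + t * ((d + f) * b) ≡ (c * a + t * (d * b)) + (e * a + t * (f * b))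
    dist₁ = ℤ-Solver.solve-∀
    dist₂ : ∀ s a b c d e f → ((c + e) * b + (d + f) * a) + s * ((d + f) * b) ≡
      ((c * b + d * a) + s * (d * b)) + ((e * b + f * a) + s * (f * b))
    dist₂ = ℤ-Solver.solve-∀
    zero₁ : ∀ t a b → 0ℤ * a + t * (0ℤ * b) ≡ 0ℤ
    zero₁ = ℤ-Solver.solve-∀
    zero₂ : ∀ s a b → (0ℤ * b + 0ℤ * a) + s * (0ℤ * b) ≡ 0ℤ
    zero₂ = ℤ-Solver.solve-∀

  open CommutativeSemiring commutativeSemiring using (1#; +-monoid)
  open Algebra.Properties.Monoid.Mult +-monoid using () renaming (_×_ to _⋆_)

  open Algebra.Properties.CommutativeSemiring.Exp commutativeSemiring using (_^_)

  ⋆-1# : ∀ n → n ⋆ 1# ≡ (+ n , 0ℤ)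
  ⋆-1# zero    = ≡.refl
  ⋆-1# (suc n) = cong (1# ⊕_) (⋆-1# n)

  ⊗-ℕ : ∀ n ((a , b) : ℤ × ℤ) → (+ n , 0ℤ) ⊗ (a , b) ≡ (+ n * a , + n * b)
  ⊗-ℕ n (a , b) = cong₂ _,_ (fst t (+ n) a b) (snd s (+ n) a b)
    where
    fst : ∀ t n a b → n * a + t * (0ℤ * b) ≡ n * a
    fst = ℤ-Solver.solve-∀
    snd : ∀ s n a b → (n * b + 0ℤ * a) + s * (0ℤ * b) ≡ n * b
    snd = ℤ-Solver.solve-∀

  ^-ℕ : ∀ k n → (+ k , 0ℤ) ^ n ≡ (+ (k ℕ.^ n) , 0ℤ)
  ^-ℕ k zero    = ≡.refl
  ^-ℕ k (suc n) = ≡.trans (cong ((+ k , 0ℤ) ⊗_) (^-ℕ k n)) (≡.trans (⊗-ℕ k (+ (k ℕ.^ n) , 0ℤ))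
    (cong₂ _,_ (≡.sym (ℤ.pos-* k (k ℕ.^ n))) (ℤ.*-zeroʳ (+ k))))

  -- Multiplication by an integer acts on each coordinate, so cancellation is inherited from ℤ.
  ⊗-cancelˡ-ℕ : ∀ n .{{_ : ℕ.NonZero n}} x y → (+ n , 0ℤ) ⊗ x ≡ (+ n , 0ℤ) ⊗ y → x ≡ y
  ⊗-cancelˡ-ℕ n x y eq = cong₂ _,_ (ℤ.*-cancelˡ-≡ (+ n) _ _ (cong proj₁ eq′)) (ℤ.*-cancelˡ-≡ (+ n) _ _ (cong proj₂ eq′))
    where
    eq′ = ≡.trans (≡.sym (⊗-ℕ n x)) (≡.trans eq (⊗-ℕ n y))

-- Poisson summation for flows and for the event Γ.

bools : List Bool
bools = true ∷ false ∷ []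

bit : Bool → ℕ
bit b = if b then 1 else 0

-- x : Fin 4 is read in binary as the character (a , b) ↦ (-1)^(low x a + high x b)
-- of 𝔽₂ × 𝔽₂.
low high : Fin 4 → ℕ
low x  = toℕ x ℕ.% 2
high x = toℕ x ℕ./ 2

pairing : Fin 4 → Bool × Bool → ℕ
pairing x (a , b) = low x ℕ.* bit a ℕ.+ high x ℕ.* bit b

module Flows {c ℓ} (R : CommutativeSemiring c ℓ) (G : Graph) where
  open CommutativeSemiring R hiding (zero) renaming (Carrier to C)
  open Algebra.Properties.CommutativeSemiring.Exp R
  open ListSum R
  open import Relation.Binary.Reasoning.Setoid setoid
  open import Algebra.Properties.CommutativeSemigroup *-commutativeSemigroup using (interchange; x∙yz≈y∙xz)

  4# : C
  4# = (1# + 1#) * (1# + 1#)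

  1#^ : ∀ n → 1# ^ n ≈ 1#
  1#^ zero    = refl
  1#^ (suc n) = trans (*-identityˡ _) (1#^ n)

  ^-% : ∀ ζ q .{{_ : ℕ.NonZero q}} → ζ ^ q ≈ 1# → ∀ k → ζ ^ k ≈ ζ ^ (k ℕ.% q)
  ^-% ζ q ζ^q≈1 k = begin
    ζ ^ k                                    ≡⟨ cong (ζ ^_) (m≡m%n+[m/n]*n k q) ⟩
    ζ ^ (k ℕ.% q ℕ.+ k ℕ./ q ℕ.* q)          ≈⟨ ^-homo-* ζ (k ℕ.% q) _ ⟩
    ζ ^ (k ℕ.% q) * ζ ^ (k ℕ./ q ℕ.* q)      ≡⟨ cong (λ j → ζ ^ (k ℕ.% q) * ζ ^ j) (ℕ.*-comm (k ℕ./ q) q) ⟩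
    ζ ^ (k ℕ.% q) * ζ ^ (q ℕ.* (k ℕ./ q))    ≈⟨ *-congˡ (^-assocʳ ζ q (k ℕ./ q)) ⟨
    ζ ^ (k ℕ.% q) * (ζ ^ q) ^ (k ℕ./ q)      ≈⟨ *-congˡ (trans (^-congˡ (k ℕ./ q) ζ^q≈1) (1#^ (k ℕ./ q))) ⟩
    ζ ^ (k ℕ.% q) * 1#                       ≈⟨ *-identityʳ _ ⟩
    ζ ^ (k ℕ.% q)                            ∎

  -- Orthogonality says that the character sum at a vertex is `N` times the indicator of the
  -- condition there; the factor `N ^ ∣V∣ G` collects one `N` per vertex. On the dual side, each
  -- edge carries the Fourier transform of `w` at the difference of its end labels.
  poisson-flows : (ζ N : C) {X Y : Set} (η τ : X → Y → ℕ) (xs : List X) (ys : List Y) (w : Y → C)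
    {Q : Vec Y (∣E∣ G) → Fin (∣V∣ G) → Set} (Q? : ∀ φ v → Dec (Q φ v)) →
    (∀ φ v → ∑ xs (λ x → ζ ^ exponent G ζ η τ φ v x) ≈ N * [ Q? φ v ]) →
    N ^ ∣V∣ G * ∑ (allVecs ys (∣E∣ G)) (λ φ → ∏ (λ e → w (lookup φ e)) * ∏ (λ v → [ Q? φ v ])) ≈
    ∑ (allVecs xs (∣V∣ G)) (λ κ → ∏ (λ e → ∑ ys (λ y →
      w y * ζ ^ (η (lookup κ (head G e)) y ℕ.+ τ (lookup κ (tail G e)) y))))
  poisson-flows ζ N η τ xs ys w Q? orthogonal = begin
    N ^ ∣V∣ G * ∑ Φ (λ φ → W φ * ∏ (λ v → [ Q? φ v ]))
      ≈⟨ ∑-distribˡ _ Φ _ ⟩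
    ∑ Φ (λ φ → N ^ ∣V∣ G * (W φ * ∏ (λ v → [ Q? φ v ])))
      ≈⟨ ∑-cong Φ (λ φ → trans (x∙yz≈y∙xz _ _ _) (*-congˡ (local φ))) ⟩
    ∑ Φ (λ φ → W φ * ∏ (λ v → ∑ xs (λ x → ζ ^ exponent G ζ η τ φ v x)))
      ≈⟨ poisson G ζ η τ xs ys w ⟩
    _ ∎
    where
    Φ = allVecs ys (∣E∣ G)
    W = λ φ → ∏ (λ e → w (lookup φ e))
    local : ∀ φ → N ^ ∣V∣ G * ∏ (λ v → [ Q? φ v ]) ≈ ∏ (λ v → ∑ xs (λ x → ζ ^ exponent G ζ η τ φ v x))
    local φ = begin
      N ^ ∣V∣ G * ∏ (λ v → [ Q? φ v ])           ≈⟨ *-congʳ (∏-const (∣V∣ G) N) ⟨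
      ∏ {∣V∣ G} (λ _ → N) * ∏ (λ v → [ Q? φ v ])  ≈⟨ ∏.∑-distrib-+ {∣V∣ G} _ _ ⟨
      ∏ (λ v → N * [ Q? φ v ])                   ≈⟨ ∏-cong (orthogonal φ) ⟨
      ∏ (λ v → ∑ xs (λ x → ζ ^ exponent G ζ η τ φ v x))  ∎

  -- A semiring has no negation; `ζ` takes the place of -1.
  module _ (ζ : C) (1+ζ≈0 : 1# + ζ ≈ 0#) where

    ζ*ζ≈1 : ζ * ζ ≈ 1#
    ζ*ζ≈1 = begin
      ζ * ζ               ≈⟨ +-identityˡ _ ⟨
      0# + ζ * ζ          ≈⟨ +-congʳ 1+ζ≈0 ⟨
      (1# + ζ) + ζ * ζ    ≈⟨ +-assoc _ _ _ ⟩
      1# + (ζ + ζ * ζ)    ≈⟨ +-congˡ (+-congʳ (*-identityʳ ζ)) ⟨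
      1# + (ζ * 1# + ζ * ζ)  ≈⟨ +-congˡ (distribˡ ζ 1# ζ) ⟨
      1# + ζ * (1# + ζ)   ≈⟨ +-congˡ (trans (*-congˡ 1+ζ≈0) (zeroʳ ζ)) ⟩
      1# + 0#             ≈⟨ +-identityʳ 1# ⟩
      1#                  ∎

    1+ζ^ : ∀ d → 1# + ζ ^ d ≈ (1# + 1#) * [ 2 ∣? d ]
    -- The decision `2 ∣? d` computes to the test of `d ℕ.% 2` against 0, so the two residues
    -- suffice.
    1+ζ^ d = trans (+-congˡ (^-% ζ 2 (trans (*-congˡ (*-identityʳ ζ)) ζ*ζ≈1) d)) (parity (d ℕ.% 2) (m%n<n d 2))
      where
      parity : ∀ r → r ℕ.< 2 → 1# + ζ ^ r ≈ (1# + 1#) * [ r ℕ.≟ 0 ]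
      parity 0 _ = sym (*-identityʳ _)
      parity 1 _ = trans (trans (+-congˡ (*-identityʳ ζ)) 1+ζ≈0) (sym (zeroʳ _))
      parity (suc (suc _)) (ℕ.s≤s (ℕ.s≤s ()))

    -- The four terms are the expansion of (1 + ζ^d)(1 + ζ^d′), one factor for each coordinate of 𝔽₂
    -- × 𝔽₂.
    ∑-pairing : ∀ d d′ → ∑ (allFin 4) (λ x → ζ ^ (low x ℕ.* d ℕ.+ high x ℕ.* d′)) ≈
                4# * ([ 2 ∣? d ] * [ 2 ∣? d′ ])
    ∑-pairing d d′ = begin
      1# + (ζ ^ (d ℕ.+ 0 ℕ.+ 0) + (ζ ^ (d′ ℕ.+ 0) + (ζ ^ (d ℕ.+ 0 ℕ.+ (d′ ℕ.+ 0)) + 0#)))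
        ≈⟨ +-congˡ (+-cong (≡⇒ (≡.trans (ℕ.+-identityʳ _) (ℕ.+-identityʳ d)))
          (+-cong (≡⇒ (ℕ.+-identityʳ d′)) (trans (+-identityʳ _)
            (trans (≡⇒ (cong₂ ℕ._+_ (ℕ.+-identityʳ d) (ℕ.+-identityʳ d′))) (^-homo-* ζ d d′))))) ⟩
      1# + (ζ ^ d + (ζ ^ d′ + ζ ^ d * ζ ^ d′))
        ≈⟨ trans (+-assoc 1# _ _) (+-congˡ (trans (sym (+-assoc _ _ _)) (trans (+-congʳ (+-comm _ _)) (+-assoc _ _ _)))) ⟨
      (1# + ζ ^ d′) + (ζ ^ d + ζ ^ d * ζ ^ d′)
        ≈⟨ +-cong (*-identityˡ _) (trans (distribˡ _ _ _) (+-congʳ (*-identityʳ _))) ⟨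
      1# * (1# + ζ ^ d′) + ζ ^ d * (1# + ζ ^ d′)   ≈⟨ distribʳ _ _ _ ⟨
      (1# + ζ ^ d) * (1# + ζ ^ d′)                 ≈⟨ *-cong (1+ζ^ d) (1+ζ^ d′) ⟩
      ((1# + 1#) * [ 2 ∣? d ]) * ((1# + 1#) * [ 2 ∣? d′ ])  ≈⟨ interchange _ _ _ _ ⟩
      4# * ([ 2 ∣? d ] * [ 2 ∣? d′ ])              ∎
      where
      ≡⇒ : ∀ {j k} → j ≡ k → ζ ^ j ≈ ζ ^ k
      ≡⇒ = ^-congʳ ζ

    -- In characteristic two a character is its own conjugate, so `pairing` serves at both ends of
    -- an edge. The flow into a vertex is then recorded by the degrees in the two coordinate
    -- subgraphs, a loop counting twice.
    exponent-degree : ∀ (φ : Vec (Bool × Bool) (∣E∣ G)) v x → exponent G ζ pairing pairing φ v x ≡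
      low x ℕ.* degree G (Vec.map proj₁ φ) v ℕ.+ high x ℕ.* degree G (Vec.map proj₂ φ) v
    exponent-degree φ v x = ≡.sym (≡.trans
      (cong₂ ℕ._+_ (ℕ∑.*-distribˡ-sum {∣E∣ G} (low x) _) (ℕ∑.*-distribˡ-sum {∣E∣ G} (high x) _))
      (≡.trans (≡.sym (ℕ∑.∑-distrib-+ {∣E∣ G} _ _)) (ℕ∑.sum-cong-≗ {∣E∣ G} local)))
      where
      if≡* : ∀ b k → (if b then k else 0) ≡ bit b ℕ.* k
      if≡* true  k = ≡.sym (ℕ.+-identityʳ k)
      if≡* false k = ≡.refl
      rearrange : ∀ l r a b h t → l ℕ.* (a ℕ.* (t ℕ.+ h)) ℕ.+ r ℕ.* (b ℕ.* (t ℕ.+ h)) ≡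
        h ℕ.* (l ℕ.* a ℕ.+ r ℕ.* b) ℕ.+ t ℕ.* (l ℕ.* a ℕ.+ r ℕ.* b)
      rearrange = ℕ-Solver.solve-∀
      at : Fin (∣V∣ G) → ℕ
      at y = bit (does (y ≟ v))
      local : ∀ e →
        low x ℕ.* (if lookup (Vec.map proj₁ φ) e then at (tail G e) ℕ.+ at (head G e) else 0) ℕ.+
        high x ℕ.* (if lookup (Vec.map proj₂ φ) e then at (tail G e) ℕ.+ at (head G e) else 0) ≡
        (if does (head G e ≟ v) then pairing x (lookup φ e) else 0) ℕ.+
        (if does (tail G e ≟ v) then pairing x (lookup φ e) else 0)
      local e rewrite lookup-map e proj₁ φ | lookup-map e proj₂ φ
        with lookup φ e | does (head G e ≟ v) | does (tail G e ≟ v)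
      ... | a , b | h | t
        rewrite if≡* a (bit t ℕ.+ bit h) | if≡* b (bit t ℕ.+ bit h)
              | if≡* h (low x ℕ.* bit a ℕ.+ high x ℕ.* bit b) | if≡* t (low x ℕ.* bit a ℕ.+ high x ℕ.* bit b)
        = rearrange (low x) (high x) (bit a) (bit b) (bit h) (bit t)

    -- This is the shape that Poisson summation needs: covering is a condition on each edge, that
    -- its value in 𝔽₂ × 𝔽₂ be nonzero, and being eulerian is a condition at each vertex.
    Γ-indicator : ∀ A B → [ Γ? G (A , B) ] ≈
      ∏ (λ e → [ lookup A e ∨ lookup B e Bool.≟ true ]) *
      ∏ (λ v → [ (2 ∣? degree G A v) ×-dec (2 ∣? degree G B v) ])
    Γ-indicator A B = begin
      [ Γ? G (A , B) ]                                     ≈⟨ [×] (eulerian? G A) (eulerian? G B ×-dec cover?) ⟩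
      [ eulerian? G A ] * [ eulerian? G B ×-dec cover? ]   ≈⟨ *-congˡ ([×] (eulerian? G B) cover?) ⟩
      [ eulerian? G A ] * ([ eulerian? G B ] * [ cover? ]) ≈⟨ *-assoc _ _ _ ⟨
      [ eulerian? G A ] * [ eulerian? G B ] * [ cover? ]   ≈⟨ *-comm _ _ ⟩
      [ cover? ] * ([ eulerian? G A ] * [ eulerian? G B ])
        ≈⟨ *-cong ([∀] cover? (λ e → lookup A e ∨ lookup B e Bool.≟ true) to from)
             (*-cong ([∀] (eulerian? G A) (λ v → 2 ∣? degree G A v) (λ p → p) (λ p → p))
                     ([∀] (eulerian? G B) (λ v → 2 ∣? degree G B v) (λ p → p) (λ p → p))) ⟩
      _ * (∏ (λ v → [ 2 ∣? degree G A v ]) * ∏ (λ v → [ 2 ∣? degree G B v ]))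
        ≈⟨ *-congˡ (∏.∑-distrib-+ {∣V∣ G} _ _) ⟨
      _ * ∏ (λ v → [ 2 ∣? degree G A v ] * [ 2 ∣? degree G B v ])
        ≈⟨ *-congˡ (∏-cong (λ v → [×] (2 ∣? degree G A v) (2 ∣? degree G B v))) ⟨
      _ ∎
      where
      cover? = ≡-dec Bool._≟_ (A ∪ B) ⊤
      to : A ∪ B ≡ ⊤ → ∀ e → lookup A e ∨ lookup B e ≡ true
      to A∪B≡⊤ e = ≡.trans (≡.sym (lookup-zipWith _∨_ e A B))
        (≡.trans (cong (λ Z → lookup Z e) A∪B≡⊤) (lookup-replicate e true))
      from : (∀ e → lookup A e ∨ lookup B e ≡ true) → A ∪ B ≡ ⊤
      from all = Pointwise-≡⇒≡ (ext λ e →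
        ≡.trans (lookup-zipWith _∨_ e A B) (≡.trans (all e) (≡.sym (lookup-replicate e true))))

    module _ (w : Bool × Bool → C) where

      -- The Fourier transform, at the bitwise sum of `p` and `q`, of `w` restricted to the nonzero
      -- elements.
      edgeWeight : Fin 4 → Fin 4 → C
      edgeWeight p q = ∑ (cartesianProduct bools bools) (λ y →
        ([ proj₁ y ∨ proj₂ y Bool.≟ true ] * w y) * ζ ^ (pairing p y ℕ.+ pairing q y))

      poisson-Γ : 4# ^ ∣V∣ G * ∑ (pairs (∣E∣ G)) (λ (A , B) →
          [ Γ? G (A , B) ] * ∏ (λ e → w (lookup A e , lookup B e))) ≈
        ∑ (allVecs (allFin 4) (∣V∣ G)) (λ κ → ∏ (λ e → edgeWeight (lookup κ (head G e)) (lookup κ (tail G e))))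
      poisson-Γ = begin
        4# ^ ∣V∣ G * ∑ (pairs (∣E∣ G)) (λ (A , B) → f A B)
          ≈⟨ *-congˡ (∑-cartesian _,_ (subsets (∣E∣ G)) (subsets (∣E∣ G)) _) ⟩
        4# ^ ∣V∣ G * ∑ (subsets (∣E∣ G)) (λ A → ∑ (subsets (∣E∣ G)) (f A))
          ≈⟨ *-congˡ (∑-unzip bools bools (∣E∣ G) f) ⟨
        4# ^ ∣V∣ G * ∑ Φ (λ φ → f (Vec.map proj₁ φ) (Vec.map proj₂ φ))
          ≈⟨ *-congˡ (∑-cong Φ regroup) ⟩
        4# ^ ∣V∣ G * ∑ Φ (λ φ → ∏ (λ e → [ proj₁ (lookup φ e) ∨ proj₂ (lookup φ e) Bool.≟ true ] * w (lookup φ e)) *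
          ∏ (λ v → [ even? φ v ]))
          ≈⟨ poisson-flows ζ 4# pairing pairing (allFin 4) (cartesianProduct bools bools)
               (λ y → [ proj₁ y ∨ proj₂ y Bool.≟ true ] * w y) even? orthogonal ⟩
        _ ∎
        where
        Φ = allVecs (cartesianProduct bools bools) (∣E∣ G)
        f : Subset (∣E∣ G) → Subset (∣E∣ G) → C
        f A B = [ Γ? G (A , B) ] * ∏ (λ e → w (lookup A e , lookup B e))
        even? : (φ : Vec (Bool × Bool) (∣E∣ G)) (v : Fin (∣V∣ G)) → Dec _
        even? φ v = (2 ∣? degree G (Vec.map proj₁ φ) v) ×-dec (2 ∣? degree G (Vec.map proj₂ φ) v)
        orthogonal : ∀ φ v → ∑ (allFin 4) (λ x → ζ ^ exponent G ζ pairing pairing φ v x) ≈ 4# * [ even? φ v ]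
        orthogonal φ v = begin
          ∑ (allFin 4) (λ x → ζ ^ exponent G ζ pairing pairing φ v x)
            ≈⟨ ∑-cong (allFin 4) (λ x → ^-congʳ ζ (exponent-degree φ v x)) ⟩
          _ ≈⟨ ∑-pairing (degree G (Vec.map proj₁ φ) v) (degree G (Vec.map proj₂ φ) v) ⟩
          _ ≈⟨ *-congˡ ([×] (2 ∣? degree G (Vec.map proj₁ φ) v) (2 ∣? degree G (Vec.map proj₂ φ) v)) ⟨
          4# * [ even? φ v ] ∎
        regroup : ∀ φ → f (Vec.map proj₁ φ) (Vec.map proj₂ φ) ≈
          ∏ (λ e → [ proj₁ (lookup φ e) ∨ proj₂ (lookup φ e) Bool.≟ true ] * w (lookup φ e)) * ∏ (λ v → [ even? φ v ])
        regroup φ = begin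
          f A B ≈⟨ *-congʳ (Γ-indicator A B) ⟩
          (∏ (λ e → [ lookup A e ∨ lookup B e Bool.≟ true ]) * _) * ∏ (λ e → w (lookup A e , lookup B e))
            ≈⟨ trans (*-assoc _ _ _) (trans (*-congˡ (*-comm _ _)) (sym (*-assoc _ _ _))) ⟩
          (∏ (λ e → [ lookup A e ∨ lookup B e Bool.≟ true ]) * ∏ (λ e → w (lookup A e , lookup B e))) * _
            ≈⟨ *-congʳ (∏.∑-distrib-+ {∣E∣ G} _ _) ⟨
          ∏ (λ e → [ lookup A e ∨ lookup B e Bool.≟ true ] * w (lookup A e , lookup B e)) * _
            ≈⟨ *-congʳ (∏-cong λ e → reflexive (cong₂ (λ a b → [ a ∨ b Bool.≟ true ] * w (a , b))
                 (lookup-map e proj₁ φ) (lookup-map e proj₂ φ))) ⟩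
          _ ∎
          where
          A = Vec.map proj₁ φ
          B = Vec.map proj₂ φ

infix 4 _≟ᶻ_
_≟ᶻ_ : (x y : ℤ × ℤ) → Dec (x ≡ y)
_≟ᶻ_ = Product.≡-dec ℤ._≟_ ℤ._≟_

-- Equality of the numbers of ℤ₄-flows and 𝔽₄-flows

module ℤ[i] = Quadratic 0ℤ -1ℤ
module ℤ[ω] = Quadratic -1ℤ -1ℤ

module _ (G : Graph) where

  open CommutativeSemiring ℤ[i].commutativeSemiring using (_*_; 1#; +-monoid; *-comm; *-cong; *-identityʳ)
  open Algebra.Properties.CommutativeSemiring.Exp ℤ[i].commutativeSemiring
  open Algebra.Properties.Monoid.Mult +-monoid using () renaming (_×_ to _⋆_)
  open Flows ℤ[i].commutativeSemiring G
  open ListSum ℤ[i].commutativeSemiring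
  open ≡.≡-Reasoning

  private
    i : ℤ × ℤ
    i = 0ℤ , 1ℤ

    ε : ℤ × ℤ
    ε = -1ℤ , 0ℤ

    -- The factor 3 stands for -1 modulo 4: the powers of `i` are a character of ℤ₄ and its
    -- conjugate.
    head-exponent tail-exponent : Fin 4 → Fin 4 → ℕ
    head-exponent x y = toℕ x ℕ.* toℕ y
    tail-exponent x y = 3 ℕ.* (toℕ x ℕ.* toℕ y)

    nonzero : Fin 4 → ℤ × ℤ
    nonzero y = [ ¬? (toℕ y ℕ.≟ 0) ]

    exponent-flow : ∀ (φ : Vec (Fin 4) (∣E∣ G)) v x → exponent G i head-exponent tail-exponent φ v x ≡
      (inflow G 4 φ v ℕ.+ outflow G 4 φ v ℕ.* 3) ℕ.* toℕ x
    exponent-flow φ v x = ≡.sym (≡.trans (cong (ℕ._* toℕ x) (≡.trans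
      (cong (inflow G 4 φ v ℕ.+_) (ℕ∑.*-distribʳ-sum {∣E∣ G} 3 _))
      (≡.sym (ℕ∑.∑-distrib-+ {∣E∣ G} _ _))))
      (≡.trans (ℕ∑.*-distribʳ-sum {∣E∣ G} (toℕ x) _) (ℕ∑.sum-cong-≗ {∣E∣ G} local)))
      where
      rearrange₀ : ∀ x y → (0 ℕ.+ y ℕ.* 3) ℕ.* x ≡ 3 ℕ.* (x ℕ.* y)
      rearrange₀ = ℕ-Solver.solve-∀
      rearrange₁ : ∀ x y → (y ℕ.+ 0) ℕ.* x ≡ x ℕ.* y ℕ.+ 0
      rearrange₁ = ℕ-Solver.solve-∀
      rearrange₂ : ∀ x y → (y ℕ.+ y ℕ.* 3) ℕ.* x ≡ x ℕ.* y ℕ.+ 3 ℕ.* (x ℕ.* y)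
      rearrange₂ = ℕ-Solver.solve-∀
      local : ∀ e →
        ((if does (head G e ≟ v) then toℕ (lookup φ e) else 0) ℕ.+
         (if does (tail G e ≟ v) then toℕ (lookup φ e) else 0) ℕ.* 3) ℕ.* toℕ x ≡
        (if does (head G e ≟ v) then head-exponent x (lookup φ e) else 0) ℕ.+
        (if does (tail G e ≟ v) then tail-exponent x (lookup φ e) else 0)
      local e with does (head G e ≟ v) | does (tail G e ≟ v)
      ... | true  | true  = rearrange₂ (toℕ x) (toℕ (lookup φ e))
      ... | true  | false = rearrange₁ (toℕ x) (toℕ (lookup φ e))
      ... | false | true  = rearrange₀ (toℕ x) (toℕ (lookup φ e))
      ... | false | false = ≡.refl

    -- Since `(i ^ toℕ b) ^ 3` is inverse to `i ^ toℕ b`, this is the sum of the first four powers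
    -- of i^(a - b). The sixteen cases are evaluated in ℤ[i].
    ∑-characters : ∀ (a b : Fin 4) →
      ∑ (allFin 4) (λ x → (i ^ toℕ a * (i ^ toℕ b) ^ 3) ^ toℕ x) ≡ 4# * [ toℕ a ℕ.≟ toℕ b ]
    ∑-characters = from-yes (all? {n = 4} λ a → all? {n = 4} λ b →
      ∑ (allFin 4) (λ x → (i ^ toℕ a * (i ^ toℕ b) ^ 3) ^ toℕ x) ≟ᶻ 4# * [ toℕ a ℕ.≟ toℕ b ])

    -- Powers of `i` depend only on residues modulo 4, which brings inflow and outflow into the
    -- range of `∑-characters`.
    orthogonal : ∀ φ v → ∑ (allFin 4) (λ x → i ^ exponent G i head-exponent tail-exponent φ v x) ≡
      4# * [ inflow G 4 φ v ℕ.% 4 ℕ.≟ outflow G 4 φ v ℕ.% 4 ]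
    orthogonal φ v = begin
      ∑ (allFin 4) (λ x → i ^ exponent G i head-exponent tail-exponent φ v x)
        ≡⟨ ∑-cong (allFin 4) (λ x → ≡.trans (cong (i ^_) (exponent-flow φ v x))
             (≡.sym (≡.trans (cong (_^ toℕ x) character) (^-assocʳ i (I ℕ.+ O ℕ.* 3) (toℕ x))))) ⟩
      ∑ (allFin 4) (λ x → (i ^ toℕ a * (i ^ toℕ b) ^ 3) ^ toℕ x)
        ≡⟨ ∑-characters a b ⟩
      4# * [ toℕ a ℕ.≟ toℕ b ]
        ≡⟨ cong₂ (λ j k → 4# * [ j ℕ.≟ k ]) (toℕ-fromℕ< (m%n<n I 4)) (toℕ-fromℕ< (m%n<n O 4)) ⟩
      4# * [ I ℕ.% 4 ℕ.≟ O ℕ.% 4 ] ∎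
      where
      I = inflow G 4 φ v
      O = outflow G 4 φ v
      a = fromℕ< (m%n<n I 4)
      b = fromℕ< (m%n<n O 4)
      i^ : ∀ k → i ^ toℕ (fromℕ< (m%n<n k 4)) ≡ i ^ k
      i^ k = ≡.trans (cong (i ^_) (toℕ-fromℕ< (m%n<n k 4))) (≡.sym (^-% i 4 ≡.refl k))
      character : i ^ toℕ a * (i ^ toℕ b) ^ 3 ≡ i ^ (I ℕ.+ O ℕ.* 3)
      character = begin
        i ^ toℕ a * (i ^ toℕ b) ^ 3  ≡⟨ cong₂ (λ y z → y * z ^ 3) (i^ I) (i^ O) ⟩
        i ^ I * (i ^ O) ^ 3          ≡⟨ cong (i ^ I *_) (^-assocʳ i O 3) ⟩
        i ^ I * i ^ (O ℕ.* 3)        ≡⟨ ^-homo-* i I (O ℕ.* 3) ⟨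
        i ^ (I ℕ.+ O ℕ.* 3)          ∎

    -- Over the nonidentity elements of a group of order four a character sums to 3 if it is trivial
    -- and to -1 otherwise. For ℤ₄ and for 𝔽₂ × 𝔽₂ alike it is trivial exactly when `p` and `q`
    -- agree, so the shared label set `Fin 4` allows a comparison edge by edge.
    edge-agree : ∀ (p q : Fin 4) →
      ∑ (allFin 4) (λ y → nonzero y * i ^ (head-exponent p y ℕ.+ tail-exponent q y)) ≡
      edgeWeight ε ≡.refl (λ _ → 1#) p q
    edge-agree = from-yes (all? λ p → all? λ q →
      ∑ (allFin 4) (λ y → nonzero y * i ^ (head-exponent p y ℕ.+ tail-exponent q y)) ≟ᶻ
      edgeWeight ε ≡.refl (λ _ → 1#) p q)

    flow-indicator : ∀ φ → [ nowhereZeroFlow? G 4 φ ] ≡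
      ∏ (λ e → nonzero (lookup φ e)) * ∏ (λ v → [ inflow G 4 φ v ℕ.% 4 ℕ.≟ outflow G 4 φ v ℕ.% 4 ])
    flow-indicator φ = ≡.trans ([×] conserved? nowhereZero?) (≡.trans (*-comm _ [ nowhereZero? ]) (*-cong
      ([∀] nowhereZero? (λ e → ¬? (toℕ (lookup φ e) ℕ.≟ 0)) (λ p → p) (λ p → p))
      ([∀] conserved? (λ v → inflow G 4 φ v ℕ.% 4 ℕ.≟ outflow G 4 φ v ℕ.% 4) (λ p → p) (λ p → p))))
      where
      conserved? = all? (λ v → inflow G 4 φ v ℕ.% 4 ℕ.≟ outflow G 4 φ v ℕ.% 4)
      nowhereZero? = all? (λ e → ¬? (toℕ (lookup φ e) ℕ.≟ 0))

  -- Multiplied by 4^|V|, both counts become the same sum over vertex labellings; the power of 4 is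
  -- then cancelled in ℤ[i].
  F≡count-Γ : F G 4 ≡ count (Γ? G) (pairs (∣E∣ G))
  F≡count-Γ = ℤ.+-injective (cong proj₁ (begin
    (+ F G 4 , 0ℤ)              ≡⟨ ℤ[i].⋆-1# (F G 4) ⟨
    F G 4 ⋆ 1#                  ≡⟨ ℤ[i].⊗-cancelˡ-ℕ (4 ℕ.^ ∣V∣ G) {{ℕ.m^n≢0 4 (∣V∣ G)}} _ _ scaled ⟩
    count (Γ? G) (pairs (∣E∣ G)) ⋆ 1#      ≡⟨ ℤ[i].⋆-1# (count (Γ? G) (pairs (∣E∣ G))) ⟩
    (+ count (Γ? G) (pairs (∣E∣ G)) , 0ℤ)  ∎))
    where
    Φ = allVecs (allFin 4) (∣E∣ G)
    scaled : (+ (4 ℕ.^ ∣V∣ G) , 0ℤ) * (F G 4 ⋆ 1#) ≡ (+ (4 ℕ.^ ∣V∣ G) , 0ℤ) * (count (Γ? G) (pairs (∣E∣ G)) ⋆ 1#)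
    scaled = begin
      (+ (4 ℕ.^ ∣V∣ G) , 0ℤ) * (F G 4 ⋆ 1#)
        ≡⟨ cong₂ _*_ (≡.sym (ℤ[i].^-ℕ 4 (∣V∣ G))) 
             (≡.trans (count-∑ (nowhereZeroFlow? G 4) Φ) (∑-cong Φ flow-indicator)) ⟩
      4# ^ ∣V∣ G * ∑ Φ (λ φ → ∏ (λ e → nonzero (lookup φ e)) *
        ∏ (λ v → [ inflow G 4 φ v ℕ.% 4 ℕ.≟ outflow G 4 φ v ℕ.% 4 ]))
        ≡⟨ poisson-flows i 4# head-exponent tail-exponent (allFin 4) (allFin 4) nonzero
             (λ φ v → inflow G 4 φ v ℕ.% 4 ℕ.≟ outflow G 4 φ v ℕ.% 4) orthogonal ⟩
      _ ≡⟨ ∑-cong (allVecs (allFin 4) (∣V∣ G)) (λ κ → ∏-cong λ e →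
             edge-agree (lookup κ (head G e)) (lookup κ (tail G e))) ⟩
      _ ≡⟨ poisson-Γ ε ≡.refl (λ _ → 1#) ⟨
      4# ^ ∣V∣ G * ∑ (pairs (∣E∣ G)) (λ (A , B) → [ Γ? G (A , B) ] * ∏ {∣E∣ G} (λ e → 1#))
        ≡⟨ cong₂ _*_ (ℤ[i].^-ℕ 4 (∣V∣ G)) (≡.trans (∑-cong (pairs (∣E∣ G)) (λ (A , B) →
             ≡.trans (cong ([ Γ? G (A , B) ] *_) (∏.sum-zero {∣E∣ G} _ (λ _ → ≡.refl))) (*-identityʳ [ Γ? G (A , B) ])))
             (≡.sym (count-∑ (Γ? G) (pairs (∣E∣ G))))) ⟩
      (+ (4 ℕ.^ ∣V∣ G) , 0ℤ) * (count (Γ? G) (pairs (∣E∣ G)) ⋆ 1#) ∎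

-- The cubic character sum

∣∣≡sum-bit : ∀ {m} (A : Subset m) → ∣ A ∣ ≡ ℕ∑.sum (λ e → bit (lookup A e))
∣∣≡sum-bit []          = ≡.refl
∣∣≡sum-bit (true ∷ A)  = cong suc (∣∣≡sum-bit A)
∣∣≡sum-bit (false ∷ A) = ∣∣≡sum-bit A

module _ (G : Graph) where

  open CommutativeSemiring ℤ[ω].commutativeSemiring using
    (_+_; _*_; 1#; +-monoid; *-identityʳ; zeroˡ; *-commutativeMonoid)
  open Algebra.Properties.CommutativeSemiring.Exp ℤ[ω].commutativeSemiring
  open Algebra.Properties.Monoid.Mult +-monoid using () renaming (_×_ to _⋆_)
  open Flows ℤ[ω].commutativeSemiring G
  open ListSum ℤ[ω].commutativeSemiring
  open ≡.≡-Reasoning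

  private
    ω ε 2# : ℤ × ℤ
    ω = 0ℤ , 1ℤ
    ε = -1ℤ , 0ℤ
    2# = 1# + 1#

    -- The 2 is -1 modulo 3, so the product over all edges is ω^(|A| - |B|). On nonzero pairs this
    -- is the cubic character, with values ω, ω² and 1 at (1,0), (0,1) and (1,1).
    weight : Bool × Bool → ℤ × ℤ
    weight (a , b) = ω ^ (bit a ℕ.+ bit b ℕ.* 2)

    pairWeight : Pair (∣E∣ G) → ℤ × ℤ
    pairWeight (A , B) = ∏ (λ e → weight (lookup A e , lookup B e))

    -- This is ω^(a - b) for residues a and b, sorted by the class of a - b and kept as indicators
    -- so that summation produces counts.
    shiftWeight : ℕ → ℕ → ℤ × ℤ
    shiftWeight a b = [ a ℕ.≟ (b ℕ.+ 0) ℕ.% 3 ] + ([ a ℕ.≟ (b ℕ.+ 1) ℕ.% 3 ] * ω + [ a ℕ.≟ (b ℕ.+ 2) ℕ.% 3 ] * (ω * ω))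

    shiftWeight-residue : ∀ (a b : Fin 3) → ω ^ toℕ a * (ω ^ toℕ b) ^ 2 ≡ shiftWeight (toℕ a) (toℕ b)
    shiftWeight-residue = from-yes (all? {n = 3} λ a → all? {n = 3} λ b →
      ω ^ toℕ a * (ω ^ toℕ b) ^ 2 ≟ᶻ shiftWeight (toℕ a) (toℕ b))

    ω^-shiftWeight : ∀ a b → ω ^ a * (ω ^ b) ^ 2 ≡
      [ a ℕ.% 3 ℕ.≟ (b ℕ.+ 0) ℕ.% 3 ] + ([ a ℕ.% 3 ℕ.≟ (b ℕ.+ 1) ℕ.% 3 ] * ω + [ a ℕ.% 3 ℕ.≟ (b ℕ.+ 2) ℕ.% 3 ] * (ω * ω))
    ω^-shiftWeight a b = begin
      ω ^ a * (ω ^ b) ^ 2                  ≡⟨ cong₂ (λ y z → y * z ^ 2) (ω^ a) (ω^ b) ⟩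
      ω ^ toℕ (r a) * (ω ^ toℕ (r b)) ^ 2  ≡⟨ shiftWeight-residue (r a) (r b) ⟩
      shiftWeight (toℕ (r a)) (toℕ (r b))  ≡⟨ cong₂ shiftWeight (toℕ-fromℕ< (m%n<n a 3)) (toℕ-fromℕ< (m%n<n b 3)) ⟩
      shiftWeight (a ℕ.% 3) (b ℕ.% 3)
        ≡⟨ cong₂ _+_ (cong (λ k → [ a ℕ.% 3 ℕ.≟ k ]) (%-distribˡ-+ b 0 3))
             (cong₂ _+_ (cong (λ k → [ a ℕ.% 3 ℕ.≟ k ] * ω) (%-distribˡ-+ b 1 3))
                        (cong (λ k → [ a ℕ.% 3 ℕ.≟ k ] * (ω * ω)) (%-distribˡ-+ b 2 3))) ⟨
      _ ∎
      where
      r : ℕ → Fin 3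
      r k = fromℕ< (m%n<n k 3)
      ω^ : ∀ k → ω ^ k ≡ ω ^ toℕ (r k)
      ω^ k = ≡.trans (^-% ω 3 ≡.refl k) (cong (ω ^_) (≡.sym (toℕ-fromℕ< (m%n<n k 3))))

    pairWeight-shift : ∀ z → pairWeight z ≡
      [ shift? G 0 z ] + ([ shift? G 1 z ] * ω + [ shift? G 2 z ] * (ω * ω))
    pairWeight-shift (A , B) = begin
      ∏ (λ e → ω ^ (bit (lookup A e) ℕ.+ bit (lookup B e) ℕ.* 2))
        ≡⟨ ^-sum ω (∣E∣ G) _ ⟩
      ω ^ ℕ∑.sum (λ e → bit (lookup A e) ℕ.+ bit (lookup B e) ℕ.* 2)
        ≡⟨ cong (ω ^_) (≡.trans (ℕ∑.∑-distrib-+ {∣E∣ G} _ _)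
             (cong₂ ℕ._+_ (≡.sym (∣∣≡sum-bit A))
               (≡.trans (≡.sym (ℕ∑.*-distribʳ-sum {∣E∣ G} 2 _)) (cong (ℕ._* 2) (≡.sym (∣∣≡sum-bit B)))))) ⟩
      ω ^ (∣ A ∣ ℕ.+ ∣ B ∣ ℕ.* 2)      ≡⟨ ^-homo-* ω ∣ A ∣ (∣ B ∣ ℕ.* 2) ⟩
      ω ^ ∣ A ∣ * ω ^ (∣ B ∣ ℕ.* 2)    ≡⟨ cong (ω ^ ∣ A ∣ *_) (^-assocʳ ω ∣ B ∣ 2) ⟨
      ω ^ ∣ A ∣ * (ω ^ ∣ B ∣) ^ 2      ≡⟨ ω^-shiftWeight ∣ A ∣ ∣ B ∣ ⟩
      _                                ∎

    -- Replacing ω² by -1 - ω leaves the differences of the counts as coordinates with respect to 1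
    -- and ω. One equation in ℤ[ω] thus carries two integer equations.
    ∑-pairWeight : ∀ zs → ∑ zs pairWeight ≡
      ( + count (shift? G 0) zs ℤ.- + count (shift? G 2) zs
      , + count (shift? G 1) zs ℤ.- + count (shift? G 2) zs)
    ∑-pairWeight zs = begin
      ∑ zs pairWeight
        ≡⟨ ∑-cong zs pairWeight-shift ⟩
      ∑ zs (λ z → [ shift? G 0 z ] + ([ shift? G 1 z ] * ω + [ shift? G 2 z ] * (ω * ω)))
        ≡⟨ ≡.trans (∑-+ zs (λ z → [ shift? G 0 z ]) _) (cong (λ y → ∑ zs (λ z → [ shift? G 0 z ]) + y)
             (∑-+ zs (λ z → [ shift? G 1 z ] * ω) (λ z → [ shift? G 2 z ] * (ω * ω)))) ⟩
      ∑ zs (λ z → [ shift? G 0 z ]) + (∑ zs (λ z → [ shift? G 1 z ] * ω) + ∑ zs (λ z → [ shift? G 2 z ] * (ω * ω)))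
        ≡⟨ cong₂ _+_ (indicators 0) (cong₂ _+_
             (≡.trans (≡.sym (∑-distribʳ ω zs _)) (cong (_* ω) (indicators 1)))
             (≡.trans (≡.sym (∑-distribʳ (ω * ω) zs _)) (cong (_* (ω * ω)) (indicators 2)))) ⟩
      (N 0 , 0ℤ) + ((N 1 , 0ℤ) * ω + (N 2 , 0ℤ) * (ω * ω))
        ≡⟨ cong₂ _,_ (first (N 0) (N 1) (N 2)) (second (N 1) (N 2)) ⟩
      (N 0 ℤ.- N 2 , N 1 ℤ.- N 2) ∎
      where
      N : ℕ → ℤ
      N k = + count (shift? G k) zs
      indicators : ∀ k → ∑ zs (λ z → [ shift? G k z ]) ≡ (N k , 0ℤ)
      indicators k = ≡.trans (≡.sym (count-∑ (shift? G k) zs)) (ℤ[ω].⋆-1# _)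
      first : ∀ x y z → x ℤ.+ ((y ℤ.* 0ℤ ℤ.+ -1ℤ ℤ.* (0ℤ ℤ.* 1ℤ)) ℤ.+
        (z ℤ.* -1ℤ ℤ.+ -1ℤ ℤ.* (0ℤ ℤ.* -1ℤ))) ≡ x ℤ.- z
      first = ℤ-Solver.solve-∀
      second : ∀ y z → 0ℤ ℤ.+ (((y ℤ.* 1ℤ ℤ.+ 0ℤ ℤ.* 0ℤ) ℤ.+ -1ℤ ℤ.* (0ℤ ℤ.* 1ℤ)) ℤ.+
        ((z ℤ.* -1ℤ ℤ.+ 0ℤ ℤ.* -1ℤ) ℤ.+ -1ℤ ℤ.* (0ℤ ℤ.* -1ℤ))) ≡ y ℤ.- z
      second = ℤ-Solver.solve-∀

    ∑-pairWeight-all : ∑ (pairs (∣E∣ G)) pairWeight ≡ 1#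
    ∑-pairWeight-all = begin
      ∑ (pairs (∣E∣ G)) pairWeight
        ≡⟨ ∑-cartesian _,_ (subsets (∣E∣ G)) (subsets (∣E∣ G)) _ ⟩
      ∑ (subsets (∣E∣ G)) (λ A → ∑ (subsets (∣E∣ G)) (λ B → pairWeight (A , B)))
        ≡⟨ ∑-unzip bools bools (∣E∣ G) (λ A B → pairWeight (A , B)) ⟨
      ∑ Φ (λ φ → pairWeight (Vec.map proj₁ φ , Vec.map proj₂ φ))
        ≡⟨ ∑-cong Φ (λ φ → ∏-cong λ e → cong₂ (λ a b → weight (a , b)) (lookup-map e proj₁ φ) (lookup-map e proj₂ φ)) ⟩
      ∑ Φ (λ φ → ∏ (λ e → weight (lookup φ e)))
        -- The sum of `weight` over the four pairs is ω³ + ω + ω² + 1, which evaluates to `1#`.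
        ≡⟨ ∏-∑ (cartesianProduct bools bools) (∣E∣ G) (λ _ → weight) ⟨
      ∏ {∣E∣ G} (λ _ → 1#)
        ≡⟨ ∏.sum-zero {∣E∣ G} _ (λ _ → ≡.refl) ⟩
      1# ∎
      where
      Φ = allVecs (cartesianProduct bools bools) (∣E∣ G)

    -- χ̄ at the bitwise sum of p and q.
    colour : Fin 4 → Fin 4 → ℤ × ℤ
    colour p q = ω ^ (2 ℕ.* ((low p ℕ.+ low q) ℕ.% 2) ℕ.+ (high p ℕ.+ high q) ℕ.% 2)

    -- Gauss sums over 𝔽₄. For equal labels the three cube roots of unity add up to 0. Otherwise one
    -- nonzero element gets the sign + and two get -, and since the cube roots add up to 0 the
    -- result is twice the root with sign +.
    edgeWeight-colour : ∀ (p q : Fin 4) →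
      edgeWeight ε ≡.refl weight p q ≡ [ ¬? (q ≟ p) ] * (2# * colour p q)
    edgeWeight-colour = from-yes (all? λ p → all? λ q →
      edgeWeight ε ≡.refl weight p q ≟ᶻ [ ¬? (q ≟ p) ] * (2# * colour p q))

    colour-sym : ∀ (p q : Fin 4) → colour p q ≡ colour q p
    colour-sym = from-yes (all? λ p → all? λ q → colour p q ≟ᶻ colour q p)

    colour-cube : ∀ (p q : Fin 4) → colour p q ^ 3 ≡ 1#
    colour-cube = from-yes (all? λ p → all? λ q → colour p q ^ 3 ≟ᶻ 1#)

    -- The three pairwise sums are nonzero and add up to zero, hence are pairwise distinct: they
    -- exhaust the nonzero elements, where the colours are 1, ω and ω².
    colour-triangle : ∀ (p q r : Fin 4) → p ≢ q → q ≢ r → r ≢ p →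
      colour p q * (colour q r * colour r p) ≡ 1#
    colour-triangle = from-yes (all? λ p → all? λ q → all? λ r →
      ¬? (p ≟ q) →-dec ¬? (q ≟ r) →-dec ¬? (r ≟ p) →-dec
      (colour p q * (colour q r * colour r p) ≟ᶻ 1#))

  module _ (cover : TriangleDoubleCover G) where

    private
      edgeColour : Vec (Fin 4) (∣V∣ G) → Fin (∣E∣ G) → ℤ × ℤ
      edgeColour κ e = colour (lookup κ (head G e)) (lookup κ (tail G e))

      ∏-colour : ∀ κ → Proper G 4 κ → ∏ (edgeColour κ) ≡ 1#
      ∏-colour κ proper = begin
        ∏ (edgeColour κ)                              ≡⟨ *-identityʳ (∏ (edgeColour κ)) ⟨
        -- The double cover makes the product of the squares trivial. Inserting it turns every
        -- factor into a cube, and the colours are cube roots of unity.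
        ∏ (edgeColour κ) * 1#                         ≡⟨ cong (∏ (edgeColour κ) *_) squares ⟨
        ∏ (edgeColour κ) * ∏ (λ e → edgeColour κ e ^ 2)   ≡⟨ ∏.∑-distrib-+ {∣E∣ G} (edgeColour κ) _ ⟨
        ∏ (λ e → edgeColour κ e ^ 3)                ≡⟨ ∏.sum-zero {∣E∣ G} _ (λ e →
                                                             colour-cube (lookup κ (head G e)) (lookup κ (tail G e))) ⟩
        1# ∎
        where
        open Triangle
        joins-colour : ∀ {e x y} → Joins G e x y → edgeColour κ e ≡ colour (lookup κ x) (lookup κ y)
        joins-colour {e} (inj₁ eq) = ≡.trans (colour-sym (lookup κ (head G e)) (lookup κ (tail G e)))
          (cong₂ (λ x y → colour (lookup κ x) (lookup κ y)) (cong proj₁ eq) (cong proj₂ eq))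
        joins-colour {e} (inj₂ eq) =
          cong₂ (λ x y → colour (lookup κ x) (lookup κ y)) (cong proj₂ eq) (cong proj₁ eq)
        joins-≢ : ∀ {e x y} → Joins G e x y → lookup κ x ≢ lookup κ y
        joins-≢ {e} (inj₁ eq) κx≡κy = proper e (≡.trans (cong (lookup κ ∘ proj₁) eq)
          (≡.trans κx≡κy (cong (lookup κ ∘ proj₂) (≡.sym eq))))
        joins-≢ {e} (inj₂ eq) κx≡κy = proper e (≡.trans (cong (lookup κ ∘ proj₁) eq)
          (≡.trans (≡.sym κx≡κy) (cong (lookup κ ∘ proj₂) (≡.sym eq))))
        triangle : ∀ (T : Triangle G) → edgeColour κ (a T) * (edgeColour κ (b T) * edgeColour κ (c T)) ≡ 1#
        triangle T = ≡.trans
          (cong₂ _*_ (joins-colour (a-joins T)) (cong₂ _*_ (joins-colour (b-joins T)) (joins-colour (c-joins T))))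
          (colour-triangle (lookup κ (u T)) (lookup κ (v T)) (lookup κ (w T))
            (joins-≢ (a-joins T)) (joins-≢ (b-joins T)) (joins-≢ (c-joins T)))
        squares : ∏ (λ e → edgeColour κ e ^ 2) ≡ 1#
        -- The exponent 2 is the number of triangles through `e`, so the product has the form
        -- treated by `sum-cover`.
        squares = ≡.trans (∏-cong λ e → cong (edgeColour κ e ^_) (≡.sym (proj₂ cover e)))
          (FinSum.sum-cover *-commutativeMonoid G (proj₁ cover) (edgeColour κ) triangle)

      ∏-edgeWeight : ∀ κ → ∏ (λ e → edgeWeight ε ≡.refl weight (lookup κ (head G e)) (lookup κ (tail G e))) ≡
        [ proper? G 4 κ ] * 2# ^ ∣E∣ G
      ∏-edgeWeight κ = begin
        ∏ (λ e → edgeWeight ε ≡.refl weight (lookup κ (head G e)) (lookup κ (tail G e)))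
          ≡⟨ ∏-cong (λ e → edgeWeight-colour (lookup κ (head G e)) (lookup κ (tail G e))) ⟩
        ∏ (λ e → [ ¬? (lookup κ (tail G e) ≟ lookup κ (head G e)) ] * (2# * edgeColour κ e))
          ≡⟨ ≡.trans (∏.∑-distrib-+ {∣E∣ G} _ _) (cong₂ _*_
               (≡.sym ([∀] (proper? G 4 κ) (λ e → ¬? (lookup κ (tail G e) ≟ lookup κ (head G e))) (λ p → p) (λ p → p)))
               (≡.trans (∏.∑-distrib-+ {∣E∣ G} _ (edgeColour κ)) (cong (_* ∏ (edgeColour κ)) (∏-const (∣E∣ G) 2#)))) ⟩
        [ proper? G 4 κ ] * (2# ^ ∣E∣ G * ∏ (edgeColour κ))
          ≡⟨ collapse (proper? G 4 κ) ⟩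
        [ proper? G 4 κ ] * 2# ^ ∣E∣ G ∎
        where
        -- The colours multiply to 1 for a proper κ; for any other κ both sides carry the factor
        -- zero.
        collapse : (d : Dec (Proper G 4 κ)) → [ d ] * (2# ^ ∣E∣ G * ∏ (edgeColour κ)) ≡ [ d ] * 2# ^ ∣E∣ G
        collapse (yes proper) = cong (1# *_) (≡.trans (cong (2# ^ ∣E∣ G *_) (∏-colour κ proper)) (*-identityʳ (2# ^ ∣E∣ G)))
        collapse (no _)       = ≡.trans (zeroˡ (2# ^ ∣E∣ G * ∏ (edgeColour κ))) (≡.sym (zeroˡ (2# ^ ∣E∣ G)))

      ∑-pairWeight-Γ : 4# ^ ∣V∣ G * ∑ (filter (Γ? G) (pairs (∣E∣ G))) pairWeight ≡ (P G 4 ⋆ 1#) * 2# ^ ∣E∣ G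
      ∑-pairWeight-Γ = begin
        4# ^ ∣V∣ G * ∑ (filter (Γ? G) (pairs (∣E∣ G))) pairWeight
          ≡⟨ cong (4# ^ ∣V∣ G *_) (∑-filter (Γ? G) (pairs (∣E∣ G)) pairWeight) ⟩
        4# ^ ∣V∣ G * ∑ (pairs (∣E∣ G)) (λ z → [ Γ? G z ] * pairWeight z)
          ≡⟨ poisson-Γ ε ≡.refl weight ⟩
        ∑ K (λ κ → ∏ (λ e → edgeWeight ε ≡.refl weight (lookup κ (head G e)) (lookup κ (tail G e))))
          ≡⟨ ∑-cong K ∏-edgeWeight ⟩
        ∑ K (λ κ → [ proper? G 4 κ ] * 2# ^ ∣E∣ G)
          ≡⟨ ∑-distribʳ (2# ^ ∣E∣ G) K _ ⟨
        ∑ K (λ κ → [ proper? G 4 κ ]) * 2# ^ ∣E∣ G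
          ≡⟨ cong (_* 2# ^ ∣E∣ G) (count-∑ (proper? G 4) K) ⟨
        (P G 4 ⋆ 1#) * 2# ^ ∣E∣ G ∎
        where
        K = allVecs (allFin 4) (∣V∣ G)

    -- The sum over Γ, scaled by 4^|V|, is an integer. Its vanishing ω-coordinate equates the
    -- classes 1 and 2, and its other coordinate gives the excess of class 0.
    shift-Γ : count (shift? G 1) (filter (Γ? G) (pairs (∣E∣ G))) ≡ count (shift? G 2) (filter (Γ? G) (pairs (∣E∣ G))) ×
      4 ℕ.^ ∣V∣ G ℕ.* count (shift? G 0) (filter (Γ? G) (pairs (∣E∣ G))) ≡
      4 ℕ.^ ∣V∣ G ℕ.* count (shift? G 2) (filter (Γ? G) (pairs (∣E∣ G))) ℕ.+ P G 4 ℕ.* 2 ℕ.^ ∣E∣ G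
    shift-Γ = ℤ.+-injective (ℤ.i-j≡0⇒i≡j _ _ (ℤ.*-cancelˡ-≡ (+ k) _ 0ℤ {{ℕ.m^n≢0 4 (∣V∣ G)}}
                (≡.trans (cong proj₂ scaled) (≡.sym (ℤ.*-zeroʳ (+ k))))))
            , ℤ.+-injective (begin
                + (k ℕ.* N 0)                              ≡⟨ ℤ.pos-* k (N 0) ⟩
                + k ℤ.* + N 0                              ≡⟨ split (+ k) (+ N 0) (+ N 2) ⟩
                + k ℤ.* + N 2 ℤ.+ + k ℤ.* (+ N 0 ℤ.- + N 2)
                  ≡⟨ cong₂ ℤ._+_ (≡.sym (ℤ.pos-* k (N 2))) (cong proj₁ scaled) ⟩
                + (k ℕ.* N 2) ℤ.+ + (P G 4 ℕ.* 2 ℕ.^ ∣E∣ G)  ∎)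
      where
      k = 4 ℕ.^ ∣V∣ G
      N : ℕ → ℕ
      N j = count (shift? G j) (filter (Γ? G) (pairs (∣E∣ G)))
      split : ∀ k x y → k ℤ.* x ≡ k ℤ.* y ℤ.+ k ℤ.* (x ℤ.- y)
      split = ℤ-Solver.solve-∀
      scaled : (+ k ℤ.* (+ N 0 ℤ.- + N 2) , + k ℤ.* (+ N 1 ℤ.- + N 2)) ≡ (+ (P G 4 ℕ.* 2 ℕ.^ ∣E∣ G) , 0ℤ)
      scaled = begin
        (+ k ℤ.* (+ N 0 ℤ.- + N 2) , + k ℤ.* (+ N 1 ℤ.- + N 2))
          ≡⟨ ℤ[ω].⊗-ℕ k _ ⟨
        (+ k , 0ℤ) * (+ N 0 ℤ.- + N 2 , + N 1 ℤ.- + N 2)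
          ≡⟨ cong₂ _*_ (≡.sym (ℤ[ω].^-ℕ 4 (∣V∣ G))) (≡.sym (∑-pairWeight (filter (Γ? G) (pairs (∣E∣ G))))) ⟩
        4# ^ ∣V∣ G * ∑ (filter (Γ? G) (pairs (∣E∣ G))) pairWeight
          ≡⟨ ∑-pairWeight-Γ ⟩
        (P G 4 ⋆ 1#) * 2# ^ ∣E∣ G
          ≡⟨ cong₂ _*_ (ℤ[ω].⋆-1# (P G 4)) (ℤ[ω].^-ℕ 2 (∣E∣ G)) ⟩
        (+ P G 4 , 0ℤ) * (+ (2 ℕ.^ ∣E∣ G) , 0ℤ)
          ≡⟨ ℤ[ω].⊗-ℕ (P G 4) _ ⟩
        (+ P G 4 ℤ.* + (2 ℕ.^ ∣E∣ G) , + P G 4 ℤ.* 0ℤ)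
          ≡⟨ cong₂ _,_ (≡.sym (ℤ.pos-* (P G 4) (2 ℕ.^ ∣E∣ G))) (ℤ.*-zeroʳ (+ P G 4)) ⟩
        (+ (P G 4 ℕ.* 2 ℕ.^ ∣E∣ G) , 0ℤ) ∎

  -- The coordinates of the sum over all pairs, which is 1.
  shift-all : count (shift? G 1) (pairs (∣E∣ G)) ≡ count (shift? G 2) (pairs (∣E∣ G)) ×
              count (shift? G 0) (pairs (∣E∣ G)) ≡ count (shift? G 2) (pairs (∣E∣ G)) ℕ.+ 1
  shift-all = ℤ.+-injective (ℤ.i-j≡0⇒i≡j _ _ (cong proj₂ unit))
            , ℤ.+-injective (≡.trans (split (+ N 0) (+ N 2)) (cong (λ x → + N 2 ℤ.+ x) (cong proj₁ unit)))
    where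
    N : ℕ → ℕ
    N j = count (shift? G j) (pairs (∣E∣ G))
    split : ∀ x y → x ≡ y ℤ.+ (x ℤ.- y)
    split = ℤ-Solver.solve-∀
    unit : (+ N 0 ℤ.- + N 2 , + N 1 ℤ.- + N 2) ≡ (1ℤ , 0ℤ)
    unit = ≡.trans (≡.sym (∑-pairWeight (pairs (∣E∣ G)))) ∑-pairWeight-all

-- Existence of a nowhere-zero 𝔽₄-flow

∈-subsets : ∀ {m} (A : Subset m) → A ∈ subsets m
∈-subsets []      = here ≡.refl
∈-subsets (true ∷ A)  = ∈-cartesianProductWith⁺ _∷_ {xs = bools} (here ≡.refl) (∈-subsets A)
∈-subsets (false ∷ A) = ∈-cartesianProductWith⁺ _∷_ {xs = bools} (there (here ≡.refl)) (∈-subsets A)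

-- The cases follow the first bits: if these all agree, the other half is free; otherwise one half
-- holds a single value, and negating its second bit avoids it.
avoid-three : (p q r : Bool × Bool) → Σ[ x ∈ Bool × Bool ] (p ≢ x × q ≢ x × r ≢ x)
avoid-three (true  , _) (true  , _) (true  , _) = (false , true) , (λ ()) , (λ ()) , λ ()
avoid-three (true  , _) (true  , _) (false , r) = (false , not r) , (λ ()) , (λ ()) , Bool.not-¬ ≡.refl ∘ cong proj₂
avoid-three (true  , _) (false , q) (true  , _) = (false , not q) , (λ ()) , (Bool.not-¬ ≡.refl ∘ cong proj₂) , λ ()
avoid-three (true  , p) (false , _) (false , _) = (true , not p) , (Bool.not-¬ ≡.refl ∘ cong proj₂) , (λ ()) , λ ()
avoid-three (false , p) (true  , _) (true  , _) = (false , not p) , (Bool.not-¬ ≡.refl ∘ cong proj₂) , (λ ()) , λ ()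
avoid-three (false , _) (true  , q) (false , _) = (true , not q) , (λ ()) , (Bool.not-¬ ≡.refl ∘ cong proj₂) , λ ()
avoid-three (false , _) (false , _) (true  , r) = (true , not r) , (λ ()) , (λ ()) , Bool.not-¬ ≡.refl ∘ cong proj₂
avoid-three (false , _) (false , _) (false , _) = (true , true) , (λ ()) , (λ ()) , λ ()

module _ (G : Graph) where
  open Triangle

  -- Symmetric difference with the triangle if `x` is true. Toggling two sets by `x` and `y` adds
  -- the constant (x , y) to the 𝔽₂ × 𝔽₂-flow along the triangle.
  toggle : Bool → Triangle G → Subset (∣E∣ G) → Subset (∣E∣ G)
  toggle x T A = tabulate λ e → lookup A e xor (x ∧ does (uses? {G} e T))

  -- The degree in a symmetric difference plus twice the degree in the intersection is the sum of
  -- the two degrees. This form avoids subtraction, and the degrees in the triangle are even.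
  eulerian-toggle : ∀ x T A → Eulerian G A → Eulerian G (toggle x T A)
  eulerian-toggle x T A eulerian z = ∣m+n∣m⇒∣n
    (≡.subst (2 ∣_) (≡.trans (≡.sym balance) (ℕ.+-comm _ (2 ℕ.* common)))
      (∣m∣n⇒∣m+n (eulerian z) even))
    (m∣m*n common)
    where
    at : Fin (∣V∣ G) → ℕ
    at y = bit (does (y ≟ z))
    ends-at : Fin (∣E∣ G) → ℕ
    ends-at e = at (tail G e) ℕ.+ at (head G e)
    cycle : Fin (∣E∣ G) → ℕ
    cycle e = if x then ends-at e else 0
    common-at : Fin (∣E∣ G) → ℕ
    common-at e = if lookup A e ∧ (x ∧ does (uses? {G} e T)) then ends-at e else 0
    common = ℕ∑.sum common-at

    toggle-bits : ∀ α x u d →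
      (if α xor (x ∧ u) then d else 0) ℕ.+ 2 ℕ.* (if α ∧ (x ∧ u) then d else 0) ≡
      (if α then d else 0) ℕ.+ (if u then (if x then d else 0) else 0)
    toggle-bits false false false d = ≡.refl
    toggle-bits false false true  d = ≡.refl
    toggle-bits false true  false d = ≡.refl
    toggle-bits false true  true  d = ℕ.+-identityʳ d
    toggle-bits true  false false d = ≡.refl
    toggle-bits true  false true  d = ≡.refl
    toggle-bits true  true  false d = ≡.refl
    toggle-bits true  true  true  d = cong (d ℕ.+_) (ℕ.+-identityʳ d)

    joins-at : ∀ {e p q} → Joins G e p q → ends-at e ≡ at p ℕ.+ at q
    joins-at (inj₁ eq) = cong₂ (λ p q → at p ℕ.+ at q) (cong proj₁ eq) (cong proj₂ eq)
    joins-at {p = p} {q} (inj₂ eq) = ≡.trans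
      (cong₂ (λ p q → at p ℕ.+ at q) (cong proj₁ eq) (cong proj₂ eq)) (ℕ.+-comm (at q) (at p))

    even-cycle : ∀ y → 2 ∣ (if y then ends-at (a T) else 0) ℕ.+
      ((if y then ends-at (b T) else 0) ℕ.+ (if y then ends-at (c T) else 0))
    even-cycle false = divides 0 ≡.refl
    -- Each vertex of the triangle is an end of two of its edges.
    even-cycle true  = divides (at (u T) ℕ.+ at (v T) ℕ.+ at (w T)) (≡.trans
      (cong₂ ℕ._+_ (joins-at (a-joins T)) (cong₂ ℕ._+_ (joins-at (b-joins T)) (joins-at (c-joins T))))
      (double (at (u T)) (at (v T)) (at (w T))))
      where
      double : ∀ x y z → x ℕ.+ y ℕ.+ (y ℕ.+ z ℕ.+ (z ℕ.+ x)) ≡ (x ℕ.+ y ℕ.+ z) ℕ.* 2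
      double = ℕ-Solver.solve-∀

    even : 2 ∣ ℕ∑.sum (λ e → if does (uses? {G} e T) then cycle e else 0)
    even = ≡.subst (2 ∣_) (≡.sym (FinSum.sum-triangle ℕ.+-0-commutativeMonoid G T cycle)) (even-cycle x)

    balance : degree G (toggle x T A) z ℕ.+ 2 ℕ.* common ≡
              degree G A z ℕ.+ ℕ∑.sum (λ e → if does (uses? {G} e T) then cycle e else 0)
    balance = ≡.trans (cong (degree G (toggle x T A) z ℕ.+_) (ℕ∑.*-distribˡ-sum {∣E∣ G} 2 common-at))
      (≡.trans (≡.sym (ℕ∑.∑-distrib-+ {∣E∣ G} _ _))
      (≡.trans (ℕ∑.sum-cong-≗ {∣E∣ G} local) (ℕ∑.∑-distrib-+ {∣E∣ G} _ _)))
      where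
      local : ∀ e → (if lookup (toggle x T A) e then ends-at e else 0) ℕ.+ 2 ℕ.* common-at e ≡
        (if lookup A e then ends-at e else 0) ℕ.+ (if does (uses? {G} e T) then cycle e else 0)
      local e = ≡.trans
        (cong (λ y → (if y then ends-at e else 0) ℕ.+ 2 ℕ.* common-at e) (lookup∘tabulate _ e))
        (toggle-bits (lookup A e) x (does (uses? {G} e T)) (ends-at e))

  eulerian-⊥ : Eulerian G ⊥
  eulerian-⊥ v = divides 0 (FinSum.sum-zero ℕ.+-0-commutativeMonoid {∣E∣ G} _ λ e → outside e _)
    where
    outside : ∀ e k → (if lookup (⊥ {∣E∣ G}) e then k else 0) ≡ 0
    outside e k = cong (λ y → if y then k else 0) (lookup-replicate e false)

  -- In characteristic two a sum vanishes only if its terms are equal. The `∧ true` is what `toggle`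
  -- leaves on an edge of the triangle.
  xor-covers : ∀ p q x y → (p , q) ≢ (x , y) → (p xor (x ∧ true)) ∨ (q xor (y ∧ true)) ≡ true
  xor-covers true  true  true  true  ≢ = contradiction ≡.refl ≢
  xor-covers true  true  true  false ≢ = ≡.refl
  xor-covers true  true  false _     ≢ = ≡.refl
  xor-covers true  false true  true  ≢ = ≡.refl
  xor-covers true  false true  false ≢ = contradiction ≡.refl ≢
  xor-covers true  false false _     ≢ = ≡.refl
  xor-covers false true  true  _     ≢ = ≡.refl
  xor-covers false true  false true  ≢ = contradiction ≡.refl ≢
  xor-covers false true  false false ≢ = ≡.refl
  xor-covers false false true  _     ≢ = ≡.refl
  xor-covers false false false true  ≢ = ≡.refl
  xor-covers false false false false ≢ = contradiction ≡.refl ≢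

  xor-∧-false : ∀ p x → p xor (x ∧ false) ≡ p
  xor-∧-false p x = ≡.trans (cong (p xor_) (Bool.∧-zeroʳ x)) (Bool.xor-identityʳ p)

  -- The flow is kept nonzero on the edges of all triangles treated so far. The shift along `T`
  -- differs from the three old values there, so the edges of `T` end up nonzero whatever they
  -- carried before, and all other edges keep their values.
  cover-triangles : (𝒯 : List (Triangle G)) → Σ[ A ∈ Subset (∣E∣ G) ] Σ[ B ∈ Subset (∣E∣ G) ]
    (Eulerian G A × Eulerian G B × (∀ e → count (uses? {G} e) 𝒯 ≢ 0 → lookup A e ∨ lookup B e ≡ true))
  cover-triangles []      = ⊥ , ⊥ , eulerian-⊥ , eulerian-⊥ , λ e 0≢0 → contradiction ≡.refl 0≢0
  cover-triangles (T ∷ 𝒯) with cover-triangles 𝒯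
  ... | A , B , eulerian-A , eulerian-B , covers
    with avoid-three (lookup A (a T) , lookup B (a T))
           (lookup A (b T) , lookup B (b T)) (lookup A (c T) , lookup B (c T))
  ... | (x , y) , ≢a , ≢b , ≢c =
    toggle x T A , toggle y T B , eulerian-toggle x T A eulerian-A , eulerian-toggle y T B eulerian-B , covers′
    where
    avoids : ∀ e → Uses {G} e T → (lookup A e , lookup B e) ≢ (x , y)
    avoids e (inj₁ ≡.refl)        = ≢a
    avoids e (inj₂ (inj₁ ≡.refl)) = ≢b
    avoids e (inj₂ (inj₂ ≡.refl)) = ≢c
    covers′ : ∀ e → count (uses? {G} e) (T ∷ 𝒯) ≢ 0 → lookup (toggle x T A) e ∨ lookup (toggle y T B) e ≡ true
    covers′ e used = ≡.trans (cong₂ _∨_ (lookup∘tabulate _ e) (lookup∘tabulate _ e)) (cases (uses? {G} e T))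
      where
      cases : (d : Dec (Uses {G} e T)) →
        (lookup A e xor (x ∧ does d)) ∨ (lookup B e xor (y ∧ does d)) ≡ true
      cases (yes uses) = xor-covers _ _ x y (avoids e uses)
      cases (no ¬uses) = ≡.trans (cong₂ _∨_ (xor-∧-false (lookup A e) x) (xor-∧-false (lookup B e) y))
        (covers e (used ∘ ≡.trans (cong length (filter-reject (uses? {G} e) ¬uses))))

  Γ-inhabited : TriangleDoubleCover G → count (Γ? G) (pairs (∣E∣ G)) ≢ 0
  Γ-inhabited (𝒯 , double) with cover-triangles 𝒯
  ... | A , B , eulerian-A , eulerian-B , covers = ℕ.>⇒≢ (∈-length (∈-filter⁺ (Γ? G)
    (∈-cartesianProduct⁺ (∈-subsets A) (∈-subsets B)) (eulerian-A , eulerian-B , A∪B≡⊤)))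
    where
    A∪B≡⊤ : A ∪ B ≡ ⊤
    A∪B≡⊤ = Pointwise-≡⇒≡ (ext λ e → ≡.trans (lookup-zipWith _∨_ e A B)
      (≡.trans (covers e λ none → contradiction (≡.trans (≡.sym (double e)) none) λ ()) (≡.sym (lookup-replicate e true))))

-- Probabilities as rational numbers

open import Data.Rational.Base using (ℚ; NonZero; _÷_; _-_; _*_; _+_; _/_; 1/_; fromℚᵘ; 0ℚ; 1ℚ; ≢-nonZero)
import Data.Rational.Properties as ℚ
import Data.Rational.Solver
open import Data.Rational.Unnormalised.Base as ℚᵘ using (mkℚᵘ; *≡*)
import Data.Rational.Unnormalised.Properties as ℚᵘ

open Data.Rational.Solver.+-*-Solver using (solve; _:+_; _:*_; _:-_; _:=_)

length-cartesianProductWith : {A B D : Set} (f : A → B → D) (xs : List A) (ys : List B) →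
  length (cartesianProductWith f xs ys) ≡ length xs ℕ.* length ys
length-cartesianProductWith f []       ys = ≡.refl
length-cartesianProductWith f (x ∷ xs) ys = ≡.trans (length-++ (map (f x) ys))
  (cong₂ ℕ._+_ (length-map (f x) ys) (length-cartesianProductWith f xs ys))

length-subsets : ∀ m → length (subsets m) ≡ 2 ℕ.^ m
length-subsets zero    = ≡.refl
length-subsets (suc m) = ≡.trans (length-cartesianProductWith _∷_ bools (subsets m)) (cong (2 ℕ.*_) (length-subsets m))

length-pairs : ∀ m → length (pairs m) ≡ 2 ℕ.^ m ℕ.* 2 ℕ.^ m
length-pairs m = ≡.trans (length-cartesianProductWith _,_ (subsets m) (subsets m))
  (cong₂ ℕ._*_ (length-subsets m) (length-subsets m))

-- Fractions in lowest terms do not compute on variables, so their arithmetic is transported from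
-- unnormalised rationals.
fromℚᵘ-homo-* : ∀ p q → fromℚᵘ (p ℚᵘ.* q) ≡ fromℚᵘ p * fromℚᵘ q
fromℚᵘ-homo-* p q = ℚ.toℚᵘ-injective (ℚᵘ.≃-trans (ℚ.toℚᵘ-fromℚᵘ (p ℚᵘ.* q))
  (ℚᵘ.≃-sym (ℚᵘ.≃-trans (ℚ.toℚᵘ-homo-* (fromℚᵘ p) (fromℚᵘ q)) (ℚᵘ.*-cong (ℚ.toℚᵘ-fromℚᵘ p) (ℚ.toℚᵘ-fromℚᵘ q)))))

fromℚᵘ-homo-+ : ∀ p q → fromℚᵘ (p ℚᵘ.+ q) ≡ fromℚᵘ p + fromℚᵘ q
fromℚᵘ-homo-+ p q = ℚ.toℚᵘ-injective (ℚᵘ.≃-trans (ℚ.toℚᵘ-fromℚᵘ (p ℚᵘ.+ q))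
  (ℚᵘ.≃-sym (ℚᵘ.≃-trans (ℚ.toℚᵘ-homo-+ (fromℚᵘ p) (fromℚᵘ q)) (ℚᵘ.+-cong (ℚ.toℚᵘ-fromℚᵘ p) (ℚ.toℚᵘ-fromℚᵘ q)))))

fromℕ-+ : ∀ a b → fromℕ (a ℕ.+ b) ≡ fromℕ a + fromℕ b
fromℕ-+ a b = ≡.trans (ℚ.fromℚᵘ-cong {mkℚᵘ (+ (a ℕ.+ b)) 0} {mkℚᵘ (+ a) 0 ℚᵘ.+ mkℚᵘ (+ b) 0}
  (*≡* (cong (ℤ._* 1ℤ) (≡.trans (ℤ.pos-+ a b)
  (≡.sym (cong₂ ℤ._+_ (ℤ.*-identityʳ (+ a)) (ℤ.*-identityʳ (+ b)))))))) (fromℚᵘ-homo-+ (mkℚᵘ (+ a) 0) (mkℚᵘ (+ b) 0))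

fromℕ-* : ∀ a b → fromℕ (a ℕ.* b) ≡ fromℕ a * fromℕ b
fromℕ-* a b = ≡.trans (ℚ.fromℚᵘ-cong {mkℚᵘ (+ (a ℕ.* b)) 0} {mkℚᵘ (+ a) 0 ℚᵘ.* mkℚᵘ (+ b) 0}
  (*≡* (cong (ℤ._* 1ℤ) (ℤ.pos-* a b)))) (fromℚᵘ-homo-* (mkℚᵘ (+ a) 0) (mkℚᵘ (+ b) 0))

/-fromℕ : ∀ a d .{{_ : ℕ.NonZero d}} → (+ a / d) * fromℕ d ≡ fromℕ a
/-fromℕ a (suc d) = ≡.trans (≡.sym (fromℚᵘ-homo-* (mkℚᵘ (+ a) d) (mkℚᵘ (+ suc d) 0)))
  (ℚ.fromℚᵘ-cong {mkℚᵘ (+ a) d ℚᵘ.* mkℚᵘ (+ suc d) 0} {mkℚᵘ (+ a) 0} (*≡* (ℤ.*-assoc (+ a) (+ suc d) 1ℤ)))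

fromℕ≡0 : ∀ n → fromℕ n ≡ 0ℚ → n ≡ 0
fromℕ≡0 n eq = ℤ.+-injective (numerator (ℚ.fromℚᵘ-injective {mkℚᵘ (+ n) 0} {mkℚᵘ 0ℤ 0} eq))
  where
  numerator : mkℚᵘ (+ n) 0 ℚᵘ.≃ mkℚᵘ 0ℤ 0 → + n ≡ 0ℤ
  numerator (*≡* eq) = ≡.trans (≡.sym (ℤ.*-identityʳ (+ n))) eq

fromℕ-nonZero : ∀ n → n ≢ 0 → NonZero (fromℕ n)
fromℕ-nonZero n n≢0 = ≢-nonZero (n≢0 ∘ fromℕ≡0 n)

*-cancelʳ : ∀ p q r .{{_ : NonZero r}} → p * r ≡ q * r → p ≡ q
*-cancelʳ p q r pr≡qr = ≡.trans (undo p) (≡.trans (cong (_* 1/ r) pr≡qr) (≡.sym (undo q)))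
  where
  undo : ∀ p → p ≡ p * r * 1/ r
  undo p = ≡.sym (≡.trans (ℚ.*-assoc p r (1/ r)) (≡.trans (cong (p *_) (ℚ.*-inverseʳ r)) (ℚ.*-identityʳ p)))

÷-* : ∀ p q r .{{_ : NonZero q}} → (p ÷ q) * (q * r) ≡ p * r
÷-* p q r = ≡.trans (solve 4 (λ p q′ q r → (p :* q′) :* (q :* r) := (p :* (q′ :* q)) :* r) ≡.refl p (1/ q) q r)
  (cong (_* r) (≡.trans (cong (p *_) (ℚ.*-inverseˡ q)) (ℚ.*-identityʳ p)))

÷-cross : ∀ p q r s .{{_ : NonZero q}} .{{_ : NonZero s}} → p * s ≡ r * q → p ÷ q ≡ r ÷ s
÷-cross p q r s ps≡rq = *-cancelʳ _ _ s (*-cancelʳ _ _ q (≡.trans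
  (≡.trans (ℚ.*-assoc (p ÷ q) s q) (≡.trans (cong ((p ÷ q) *_) (ℚ.*-comm s q)) (÷-* p q s)))
  (≡.trans ps≡rq (≡.sym (≡.trans (ℚ.*-assoc (r ÷ s) s q) (÷-* r s q))))))

-- The exponent may have either sign; multiplying by 2^b clears a possible denominator.
2^-⊖ : ∀ a b → 2^ (a ℤ.⊖ b) * fromℕ (2 ℕ.^ b) ≡ fromℕ (2 ℕ.^ a)
2^-⊖ a b with ℕ.≤-total b a
... | inj₁ b≤a = ≡.trans (cong (λ i → 2^ i * fromℕ (2 ℕ.^ b)) (ℤ.⊖-≥ b≤a))
  (≡.trans (≡.sym (fromℕ-* (2 ℕ.^ (a ℕ.∸ b)) (2 ℕ.^ b)))
  (cong fromℕ (≡.trans (≡.sym (ℕ.^-distribˡ-+-* 2 (a ℕ.∸ b) b)) (cong (2 ℕ.^_) (ℕ.m∸n+n≡m b≤a)))))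
... | inj₂ a≤b = ≡.trans (cong₂ (λ i j → 2^ i * fromℕ (2 ℕ.^ j)) (ℤ.⊖-≤ a≤b) (≡.sym (ℕ.m∸n+n≡m a≤b)))
  (≡.trans (cong (2^ (ℤ.- + d) *_) (≡.trans (cong fromℕ (ℕ.^-distribˡ-+-* 2 d a)) (fromℕ-* (2 ℕ.^ d) (2 ℕ.^ a))))
  (≡.trans (≡.sym (ℚ.*-assoc (2^ (ℤ.- + d)) (fromℕ (2 ℕ.^ d)) (fromℕ (2 ℕ.^ a))))
  (≡.trans (cong (_* fromℕ (2 ℕ.^ a)) (inverse d)) (ℚ.*-identityˡ _))))
  where
  d = b ℕ.∸ a
  inverse : ∀ d → 2^ (ℤ.- + d) * fromℕ (2 ℕ.^ d) ≡ 1ℚ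
  inverse zero    = ≡.refl
  inverse (suc d) = /-fromℕ 1 (2 ℕ.^ suc d) {{ℕ.m^n≢0 2 (suc d)}}

module _ {m : ℕ} where

  private
    t : ℚ
    t = fromℕ (length (pairs m))

  ℙ-count : {S : Pred (Pair m) 0ℓ} (S? : Decidable S) → ℙ S? * t ≡ fromℕ (count S? (pairs m))
  ℙ-count S? = /-fromℕ (count S? (pairs m)) (length (pairs m)) {{pairs-nonZero m}}

  -- An event and its complement together have count t, so x - (t - x) = 2x - t. In a difference of
  -- biases t cancels.
  Bias-count : {S : Pred (Pair m) 0ℓ} (S? : Decidable S) →
    Bias S? * t ≡ fromℕ (count S? (pairs m)) + fromℕ (count S? (pairs m)) - t
  Bias-count S? = begin
    (ℙ S? - ℙ (∁? S?)) * t       ≡⟨ solve 3 (λ x y t → (x :- y) :* t := x :* t :- y :* t) ≡.refl (ℙ S?) (ℙ (∁? S?)) t ⟩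
    ℙ S? * t - ℙ (∁? S?) * t     ≡⟨ cong₂ _-_ (ℙ-count S?) (ℙ-count (∁? S?)) ⟩
    x - y                        ≡⟨ solve 2 (λ x y → x :- y := x :+ x :- (x :+ y)) ≡.refl x y ⟩
    x + x - (x + y)              ≡⟨ cong (λ z → x + x - z) (≡.trans (≡.sym (fromℕ-+ (count S? (pairs m)) (count (∁? S?) (pairs m))))
                                      (cong fromℕ (count-∁ S? (pairs m)))) ⟩
    x + x - t                    ∎
    where
    open ≡.≡-Reasoning
    x = fromℕ (count S? (pairs m))
    y = fromℕ (count (∁? S?) (pairs m))

  ℙ∣-count : {S T : Pred (Pair m) 0ℓ} (S? : Decidable S) (T? : Decidable T) .{{_ : NonZero (ℙ T?)}} →
    ℙ[ S? ∣ T? ] * fromℕ (count T? (pairs m)) ≡ fromℕ (count S? (filter T? (pairs m)))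
  ℙ∣-count S? T? = begin
    ℙ[ S? ∣ T? ] * fromℕ (count T? (pairs m))     ≡⟨ cong (ℙ[ S? ∣ T? ] *_) (ℙ-count T?) ⟨
    (ℙ (S? ∩? T?) ÷ ℙ T?) * (ℙ T? * t)           ≡⟨ ÷-* (ℙ (S? ∩? T?)) (ℙ T?) t ⟩
    ℙ (S? ∩? T?) * t                             ≡⟨ ℙ-count (S? ∩? T?) ⟩
    fromℕ (count (S? ∩? T?) (pairs m))           ≡⟨ cong fromℕ (count-∩ S? T? (pairs m)) ⟩
    fromℕ (count S? (filter T? (pairs m)))       ∎
    where open ≡.≡-Reasoning

  Bias∣-count : {S T : Pred (Pair m) 0ℓ} (S? : Decidable S) (T? : Decidable T) .{{_ : NonZero (ℙ T?)}} →
    Bias[ S? ∣ T? ] * fromℕ (count T? (pairs m)) ≡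
    fromℕ (count S? (filter T? (pairs m))) + fromℕ (count S? (filter T? (pairs m))) - fromℕ (count T? (pairs m))
  Bias∣-count S? T? = begin
    (ℙ[ S? ∣ T? ] - ℙ[ ∁? S? ∣ T? ]) * f
      ≡⟨ solve 3 (λ x y t → (x :- y) :* t := x :* t :- y :* t) ≡.refl ℙ[ S? ∣ T? ] ℙ[ ∁? S? ∣ T? ] f ⟩
    ℙ[ S? ∣ T? ] * f - ℙ[ ∁? S? ∣ T? ] * f     ≡⟨ cong₂ _-_ (ℙ∣-count S? T?) (ℙ∣-count (∁? S?) T?) ⟩
    x - y                        ≡⟨ solve 2 (λ x y → x :- y := x :+ x :- (x :+ y)) ≡.refl x y ⟩
    x + x - (x + y)              ≡⟨ cong (λ z → x + x - z) (≡.trans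
                                      (≡.sym (fromℕ-+ (count S? (filter T? (pairs m))) (count (∁? S?) (filter T? (pairs m)))))
                                      (cong fromℕ (count-∁ S? (filter T? (pairs m))))) ⟩
    x + x - f                    ∎
    where
    open ≡.≡-Reasoning
    f = fromℕ (count T? (pairs m))
    x = fromℕ (count S? (filter T? (pairs m)))
    y = fromℕ (count (∁? S?) (filter T? (pairs m)))

-- From the counts to the identities between biases.

theorem4p2 : (G : Graph) → TriangleDoubleCover G →
    Σ[ Γ≢0 ∈ NonZero (ℙ (Γ? G)) ]
    Σ[ D≢0 ∈ NonZero (Bias (shift? G 0) - Bias (shift? G 1)) ]
    Σ[ F≢0 ∈ NonZero (fromℕ (F G 4)) ]
    ( Bias[ shift? G 1 ∣ Γ? G ] {{Γ≢0}} ≡ Bias[ shift? G 2 ∣ Γ? G ] {{Γ≢0}}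
    × ((Bias[ shift? G 0 ∣ Γ? G ] {{Γ≢0}} - Bias[ shift? G 1 ∣ Γ? G ] {{Γ≢0}})
    ÷ (Bias (shift? G 0) - Bias (shift? G 1))) {{D≢0}}
    ≡ ((2^ ((+ 3) ℤ.* (+ ∣E∣ G) ℤ.- (+ 2) ℤ.* (+ ∣V∣ G)) * fromℕ (P G 4))
    ÷ fromℕ (F G 4)) {{F≢0}} )
theorem4p2 G cover = Γ≢0 , D≢0 , F≢0
  , *-cancelʳ (bias 1) (bias 2) f {{f≢0}} (begin
      bias 1 * f          ≡⟨ Bias∣-count (shift? G 1) (Γ? G) {{Γ≢0}} ⟩
      n 1 + n 1 - f       ≡⟨ cong (λ x → x + x - f) n₁≡n₂ ⟩
      n 2 + n 2 - f       ≡⟨ Bias∣-count (shift? G 2) (Γ? G) {{Γ≢0}} ⟨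
      bias 2 * f          ∎)
  , ÷-cross (bias 0 - bias 1) D (z * p) (fromℕ (F G 4)) {{D≢0}} {{F≢0}}
      -- After cross-multiplication, `t` clears the denominator of `D` and `k` the 4^|V| from
      -- Poisson summation. Both sides then equal twice p s t, the 2 coming from the doubling of
      -- counts in a bias.
      (*-cancelʳ _ _ t {{t≢0}} (*-cancelʳ _ _ k {{k≢0}} (begin
        (bias 0 - bias 1) * fromℕ (F G 4) * t * k
          ≡⟨ cong (λ x → (bias 0 - bias 1) * fromℕ x * t * k) (F≡count-Γ G) ⟩
        (bias 0 - bias 1) * f * t * k
          ≡⟨ cong (λ x → x * t * k) (≡.trans (*-distribʳ-- (bias 0) (bias 1) f) (cong₂ _-_
               (Bias∣-count (shift? G 0) (Γ? G) {{Γ≢0}})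
               (≡.trans (Bias∣-count (shift? G 1) (Γ? G) {{Γ≢0}}) (cong (λ x → x + x - f) n₁≡n₂)))) ⟩
        ((n 0 + n 0 - f) - (n 2 + n 2 - f)) * t * k
          ≡⟨ solve 5 (λ x y f t k → ((x :+ x :- f) :- (y :+ y :- f)) :* t :* k := (k :* x :+ k :* x :- (k :* y :+ k :* y)) :* t)
               ≡.refl (n 0) (n 2) f t k ⟩
        (k * n 0 + k * n 0 - (k * n 2 + k * n 2)) * t
          ≡⟨ cong (λ x → (x + x - (k * n 2 + k * n 2)) * t) n₀ ⟩
        (k * n 2 + p * s + (k * n 2 + p * s) - (k * n 2 + k * n 2)) * t
          ≡⟨ solve 4 (λ y p s t → (y :+ p :* s :+ (y :+ p :* s) :- (y :+ y)) :* t := p :* (s :* t) :+ p :* (s :* t))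
               ≡.refl (k * n 2) p s t ⟩
        p * (s * t) + p * (s * t)
          ≡⟨ cong (λ x → p * x + p * x) s*t ⟩
        p * (z * k) + p * (z * k)
          ≡⟨ solve 3 (λ p z k → p :* (z :* k) :+ p :* (z :* k) := z :* p :* k :+ z :* p :* k) ≡.refl p z k ⟩
        z * p * k + z * p * k
          ≡⟨ cong₂ _+_ (≡.sym (ℚ.*-identityʳ (z * p * k))) (≡.sym (ℚ.*-identityʳ (z * p * k))) ⟩
        z * p * k * 1ℚ + z * p * k * 1ℚ
          ≡⟨ ≡.sym (ℚ.*-distribˡ-+ (z * p * k) 1ℚ 1ℚ) ⟩
        z * p * k * (1ℚ + 1ℚ)
          ≡⟨ cong (z * p * k *_) D*t ⟨
        z * p * k * (D * t)
          ≡⟨ solve 4 (λ y k D t → y :* k :* (D :* t) := y :* D :* t :* k) ≡.refl (z * p) k D t ⟩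
        z * p * D * t * k ∎)))
  where
  open ≡.≡-Reasoning

  Ω = pairs (∣E∣ G)
  D = Bias (shift? G 0) - Bias (shift? G 1)
  f = fromℕ (count (Γ? G) Ω)
  t = fromℕ (length Ω)
  k = fromℕ (4 ℕ.^ ∣V∣ G)
  s = fromℕ (2 ℕ.^ ∣E∣ G)
  p = fromℕ (P G 4)
  z = 2^ ((+ 3) ℤ.* (+ ∣E∣ G) ℤ.- (+ 2) ℤ.* (+ ∣V∣ G))

  n c : ℕ → ℚ
  n j = fromℕ (count (shift? G j) (filter (Γ? G) Ω))
  c j = fromℕ (count (shift? G j) Ω)

  *-distribʳ-- : ∀ x y z → (x - y) * z ≡ x * z - y * z
  *-distribʳ-- = solve 3 (λ x y z → (x :- y) :* z := x :* z :- y :* z) ≡.refl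

  f≢0 : NonZero f
  f≢0 = fromℕ-nonZero _ (Γ-inhabited G cover)

  F≢0 : NonZero (fromℕ (F G 4))
  F≢0 = fromℕ-nonZero _ (Γ-inhabited G cover ∘ ≡.trans (≡.sym (F≡count-Γ G)))

  k≢0 : NonZero k
  k≢0 = fromℕ-nonZero _ (ℕ.≢-nonZero⁻¹ _ {{ℕ.m^n≢0 4 (∣V∣ G)}})

  t≢0 : NonZero t
  t≢0 = fromℕ-nonZero _ (ℕ.≢-nonZero⁻¹ _ {{pairs-nonZero (∣E∣ G)}})

  Γ≢0 : NonZero (ℙ (Γ? G))
  Γ≢0 = ≢-nonZero {ℙ (Γ? G)} λ ℙ≡0 → Γ-inhabited G cover (fromℕ≡0 (count (Γ? G) Ω)
    (≡.trans (≡.sym (ℙ-count (Γ? G))) (≡.trans (cong (_* t) ℙ≡0) (ℚ.*-zeroˡ t))))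

  bias : ℕ → ℚ
  bias j = Bias[ shift? G j ∣ Γ? G ] {{Γ≢0}}

  n₁≡n₂ : n 1 ≡ n 2
  n₁≡n₂ = cong fromℕ (proj₁ (shift-Γ G cover))

  n₀ : k * n 0 ≡ k * n 2 + p * s
  n₀ = begin
    k * n 0  ≡⟨ fromℕ-* (4 ℕ.^ ∣V∣ G) _ ⟨
    fromℕ (4 ℕ.^ ∣V∣ G ℕ.* count (shift? G 0) (filter (Γ? G) Ω))  ≡⟨ cong fromℕ (proj₂ (shift-Γ G cover)) ⟩
    _  ≡⟨ fromℕ-+ (4 ℕ.^ ∣V∣ G ℕ.* count (shift? G 2) (filter (Γ? G) Ω)) _ ⟩
    _  ≡⟨ cong₂ _+_ (fromℕ-* (4 ℕ.^ ∣V∣ G) _) (fromℕ-* (P G 4) _) ⟩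
    k * n 2 + p * s ∎

  -- Over all pairs class 0 exceeds class 1 by exactly one, which the bias doubles. In particular
  -- `D` is nonzero.
  D*t : D * t ≡ 1ℚ + 1ℚ
  D*t = begin
    D * t  ≡⟨ *-distribʳ-- (Bias (shift? G 0)) (Bias (shift? G 1)) t ⟩
    _      ≡⟨ cong₂ _-_ (Bias-count (shift? G 0)) (Bias-count (shift? G 1)) ⟩
    (c 0 + c 0 - t) - (c 1 + c 1 - t)
           ≡⟨ cong₂ (λ x y → (x + x - t) - (y + y - t))
                (≡.trans (cong fromℕ (proj₂ (shift-all G))) (fromℕ-+ (count (shift? G 2) Ω) 1))
                (cong fromℕ (proj₁ (shift-all G))) ⟩
    (c 2 + 1ℚ + (c 2 + 1ℚ) - t) - (c 2 + c 2 - t)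
           ≡⟨ solve 3 (λ x u t → (x :+ u :+ (x :+ u) :- t) :- (x :+ x :- t) := u :+ u) ≡.refl (c 2) 1ℚ t ⟩
    1ℚ + 1ℚ ∎

  D≢0 : NonZero D
  D≢0 = ≢-nonZero {D} λ D≡0 → contradiction
    (≡.trans (≡.sym D*t) (≡.trans (cong (_* t) D≡0) (ℚ.*-zeroˡ t))) λ ()

  -- The source of the power of two: 2^|E| from the Gauss sums times the 4^|E| pairs, against 4^|V|
  -- from Poisson summation.
  s*t : s * t ≡ z * k
  s*t = begin
    s * t                                    ≡⟨ fromℕ-* (2 ℕ.^ ∣E∣ G) _ ⟨
    fromℕ (2 ℕ.^ ∣E∣ G ℕ.* length Ω)         ≡⟨ cong fromℕ (≡.trans
                                                  (cong (2 ℕ.^ ∣E∣ G ℕ.*_) (length-pairs (∣E∣ G))) (cube (∣E∣ G))) ⟩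
    fromℕ (2 ℕ.^ (3 ℕ.* ∣E∣ G))              ≡⟨ 2^-⊖ (3 ℕ.* ∣E∣ G) (2 ℕ.* ∣V∣ G) ⟨
    2^ (3 ℕ.* ∣E∣ G ℤ.⊖ 2 ℕ.* ∣V∣ G) * fromℕ (2 ℕ.^ (2 ℕ.* ∣V∣ G))
      ≡⟨ cong₂ (λ i j → 2^ i * fromℕ j)
           (≡.trans (≡.sym (ℤ.m-n≡m⊖n (3 ℕ.* ∣E∣ G) (2 ℕ.* ∣V∣ G))) (cong₂ ℤ._-_ (ℤ.pos-* 3 (∣E∣ G)) (ℤ.pos-* 2 (∣V∣ G))))
           (≡.sym (ℕ.^-*-assoc 2 2 (∣V∣ G))) ⟩
    z * k ∎
    where
    cube : ∀ m → 2 ℕ.^ m ℕ.* (2 ℕ.^ m ℕ.* 2 ℕ.^ m) ≡ 2 ℕ.^ (3 ℕ.* m)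
    cube m = ≡.sym (≡.trans (ℕ.^-distribˡ-+-* 2 m _) (cong (2 ℕ.^ m ℕ.*_)
      (≡.trans (ℕ.^-distribˡ-+-* 2 m _) (cong (λ j → 2 ℕ.^ m ℕ.* 2 ℕ.^ j) (ℕ.+-identityʳ m)))))
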